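{- There exist absolute constants $C,c>0$ such that the following holds for every perfect square $n$ with $\sqrt{n}\ge 3$. Let $G$ be the $\sqrt{n}\times\sqrt{n}$ grid graph and let $H$ be the cycle of $G$ formed by the vertices on the outer boundary of the grid. Then the optimal value of the earthmover linear programming relaxation for minimum-stretch retraction of $G$ to $H$ is at most $C$, while every retraction of $G$ to $H$ has stretch at least $c\sqrt{n}$. In particular, the earthmover relaxation has integrality gap $\Omega(\sqrt{n})$ on this instance.
   Context: Let $G=(V,E)$ be an unweighted graph and $H=(A,E')$ a subgraph of $G$. A retraction of $G$ to $H$ is a map $f:V\to A$ with $f(v)=v$ for all $v\in A$. Let $d_H$ be the shortest-path metric of $H$. The stretch of an edge $(u,v)\in E$ under $f$ is $d_H(f(u),f(v))$, and the stretch of $f$ is the maximum stretch over all edges of $G$. The earthmover LP relaxation for retracting $G$ to $H$ has real variables $s$, $x^u_j$ ($u\in V$, $j\in A$), and $f^{uv}_{ij}$ ($(u,v)\in E$, $i,j\in A$), and is: minimize $s$ subject to $$x^u_j-x^v_j+\sum_{i\in A}\bigl(f^{uv}_{ij}-f^{uv}_{ji}\bigr)=0\quad\forall (u,v)\in E,\ j\in A,$$ $$\sum_{j\in A}x^u_j=1\quad\forall u\in V,\qquad \sum_{i\in A}\sum_{j\in A}d_H(i,j)\,f^{uv}_{ij}\le s\quad\forall (u,v)\in E,$$ $$x^a_a=1\quad\forall a\in A,\qquad x,f\ge 0.$$ That is, each vertex $u$ is assigned a probability distribution $x^u$ on the anchors (a point mass at itself if $u$ is an anchor), and $s$ bounds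 the earthmover distance with respect to $d_H$ between $x^u$ and $x^v$ for each edge $(u,v)$. The $m\times m$ grid graph has vertex set $\{1,\dots,m\}^2$, with two vertices adjacent iff they differ by exactly 1 in exactly one coordinate. -}

module Defs where

open import Data.Nat.Base as ℕ using (ℕ; zero; suc; _⊔_; ∣_-_∣)
import Data.Nat.Properties as ℕ
open import Data.Integer.Base using (+_)
open import Data.Rational.Base as ℚ using (ℚ; 0ℚ; 1ℚ; ½)
import Data.Rational.Properties as ℚ
open import Data.Rational.Solver using (module +-*-Solver)
open import Data.Fin.Base using (Fin; toℕ)
import Data.Fin.Properties as Fin
open import Data.List.Base using (List; []; _∷_; map; foldr; filter; length; allFin; cartesianProduct)
open import Data.List.Extrema.Nat using (max)
open import Data.List.Membership.Propositional using (_∈_; find; lose)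
open import Data.List.Membership.Propositional.Properties using (∈-cartesianProduct⁺; ∈-allFin)
open import Data.List.Relation.Unary.Any using (any?)
open import Data.List.Relation.Unary.Unique.Propositional using (Unique)
open import Data.List.Relation.Unary.Unique.Propositional.Properties
  using (cartesianProduct⁺; allFin⁺)
open import Data.Product using (∃; _×_; _,_; proj₁; proj₂)
open import Data.Product.Properties using (≡-dec)
open import Data.Sum.Base using (_⊎_; inj₁; inj₂)
open import Relation.Binary.Definitions using (DecidableEquality; Symmetric; Irreflexive; Decidable)
open import Relation.Binary.PropositionalEquality
  using (_≡_; refl; sym; trans; cong; subst)
open import Relation.Nullary using (Dec; yes; no; contradiction)
open import Relation.Nullary.Decidable using (map′; _×-dec_; _⊎-dec_)
import Relation.Unary as Unary

ℕ→ℚ : ℕ → ℚ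
ℕ→ℚ k = + k ℚ./ 1

------------------------------------------------------------------------
-- Real numbers as Cauchy sequences of rationals.  Only the ordered
-- ℚ-vector-space structure is set up, since a linear program with rational
-- coefficients needs nothing more.

record ℝ : Set where
  constructor mkℝ
  field
    seq    : ℕ → ℚ
    cauchy : ∀ ε → 0ℚ ℚ.< ε →
             ∃ λ N → ∀ k l → N ℕ.≤ k → N ℕ.≤ l → ℚ.∣ seq k ℚ.- seq l ∣ ℚ.≤ ε

open ℝ public

infix 4 _≤ᵣ_ _≈ᵣ_

_≤ᵣ_ : ℝ → ℝ → Set
x ≤ᵣ y = ∀ ε → 0ℚ ℚ.< ε → ∃ λ N → ∀ k → N ℕ.≤ k → seq x k ℚ.≤ seq y k ℚ.+ ε

_≈ᵣ_ : ℝ → ℝ → Set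
x ≈ᵣ y = x ≤ᵣ y × y ≤ᵣ x

fromℚ : ℚ → ℝ
fromℚ q .seq _ = q
fromℚ q .cauchy ε 0<ε = 0 , λ _ _ _ _ →
  subst (λ z → ℚ.∣ z ∣ ℚ.≤ ε) (sym (ℚ.+-inverseʳ q)) (ℚ.<⇒≤ 0<ε)

0ᵣ 1ᵣ : ℝ
0ᵣ = fromℚ 0ℚ
1ᵣ = fromℚ 1ℚ

infixl 6 _+ᵣ_ _-ᵣ_
infixl 7 _·_

private
  half : ∀ ε → 0ℚ ℚ.< ε → 0ℚ ℚ.< ½ ℚ.* ε
  half ε 0<ε = ℚ.positive⁻¹ (½ ℚ.* ε) {{ℚ.pos*pos⇒pos ½ ε {{ℚ.positive 0<ε}}}}

  halves : ∀ ε → ½ ℚ.* ε ℚ.+ ½ ℚ.* ε ≡ ε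
  halves ε = trans (sym (ℚ.*-distribʳ-+ ε ½ ½)) (ℚ.*-identityˡ ε)

  regroup : ∀ a b c d → (a ℚ.+ b) ℚ.- (c ℚ.+ d) ≡ (a ℚ.- c) ℚ.+ (b ℚ.- d)
  regroup = solve 4 (λ a b c d → (a :+ b) :- (c :+ d) := (a :- c) :+ (b :- d)) refl
    where open +-*-Solver

  factor : ∀ q a b → q ℚ.* a ℚ.- q ℚ.* b ≡ q ℚ.* (a ℚ.- b)
  factor = solve 3 (λ q a b → q :* a :- q :* b := q :* (a :- b)) refl
    where open +-*-Solver

_+ᵣ_ : ℝ → ℝ → ℝ
(x +ᵣ y) .seq k = seq x k ℚ.+ seq y k
(x +ᵣ y) .cauchy ε 0<ε with cauchy x (½ ℚ.* ε) (half ε 0<ε) | cauchy y (½ ℚ.* ε) (half ε 0<ε)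
... | M , p | N , q = M ⊔ N , λ k l k≥ l≥ → begin
  ℚ.∣ (seq x k ℚ.+ seq y k) ℚ.- (seq x l ℚ.+ seq y l) ∣
    ≡⟨ cong ℚ.∣_∣ (regroup (seq x k) (seq y k) (seq x l) (seq y l)) ⟩
  ℚ.∣ (seq x k ℚ.- seq x l) ℚ.+ (seq y k ℚ.- seq y l) ∣
    ≤⟨ ℚ.∣p+q∣≤∣p∣+∣q∣ (seq x k ℚ.- seq x l) (seq y k ℚ.- seq y l) ⟩
  ℚ.∣ seq x k ℚ.- seq x l ∣ ℚ.+ ℚ.∣ seq y k ℚ.- seq y l ∣
    ≤⟨ ℚ.+-mono-≤ (p k l (ℕ.m⊔n≤o⇒m≤o M N k≥) (ℕ.m⊔n≤o⇒m≤o M N l≥))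
                  (q k l (ℕ.m⊔n≤o⇒n≤o M N k≥) (ℕ.m⊔n≤o⇒n≤o M N l≥)) ⟩
  ½ ℚ.* ε ℚ.+ ½ ℚ.* ε
    ≡⟨ halves ε ⟩
  ε ∎
  where open ℚ.≤-Reasoning

_·_ : ℚ → ℝ → ℝ
(q · x) .seq k = q ℚ.* seq x k
(q · x) .cauchy ε 0<ε = proj₁ modulus , λ k l k≥ l≥ → begin
  ℚ.∣ q ℚ.* seq x k ℚ.- q ℚ.* seq x l ∣
    ≡⟨ cong ℚ.∣_∣ (factor q (seq x k) (seq x l)) ⟩
  ℚ.∣ q ℚ.* (seq x k ℚ.- seq x l) ∣
    ≡⟨ ℚ.∣p*q∣≡∣p∣*∣q∣ q (seq x k ℚ.- seq x l) ⟩
  ℚ.∣ q ∣ ℚ.* ℚ.∣ seq x k ℚ.- seq x l ∣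
    ≤⟨ ℚ.*-monoʳ-≤-nonNeg (ℚ.∣ seq x k ℚ.- seq x l ∣) {{ℚ.∣-∣-nonNeg (seq x k ℚ.- seq x l)}} ∣q∣≤B ⟩
  B ℚ.* ℚ.∣ seq x k ℚ.- seq x l ∣
    ≤⟨ ℚ.*-monoˡ-≤-nonNeg B {{ℚ.pos⇒nonNeg B}} (proj₂ modulus k l k≥ l≥) ⟩
  B ℚ.* (ℚ.1/ B ℚ.* ε)
    ≡⟨ sym (ℚ.*-assoc B (ℚ.1/ B) ε) ⟩
  B ℚ.* ℚ.1/ B ℚ.* ε
    ≡⟨ cong (ℚ._* ε) (ℚ.*-inverseʳ B) ⟩
  1ℚ ℚ.* ε
    ≡⟨ ℚ.*-identityˡ ε ⟩
  ε ∎
  where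
  open ℚ.≤-Reasoning

  B : ℚ
  B = ℚ.∣ q ∣ ℚ.+ 1ℚ

  instance
    B>0 : ℚ.Positive B
    B>0 = ℚ.nonNeg+pos⇒pos ℚ.∣ q ∣ {{ℚ.∣-∣-nonNeg q}} 1ℚ

    B≢0 : ℚ.NonZero B
    B≢0 = ℚ.pos⇒nonZero B

  ∣q∣≤B : ℚ.∣ q ∣ ℚ.≤ B
  ∣q∣≤B = subst (ℚ._≤ B) (ℚ.+-identityʳ ℚ.∣ q ∣)
            (ℚ.+-monoʳ-≤ ℚ.∣ q ∣ (ℚ.<⇒≤ (ℚ.positive⁻¹ 1ℚ)))

  modulus = cauchy x (ℚ.1/ B ℚ.* ε)
    (ℚ.positive⁻¹ (ℚ.1/ B ℚ.* ε)
      {{ℚ.pos*pos⇒pos (ℚ.1/ B) {{ℚ.1/pos⇒pos B}} ε {{ℚ.positive 0<ε}}}})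

_-ᵣ_ : ℝ → ℝ → ℝ
x -ᵣ y = x +ᵣ (ℚ.- 1ℚ) · y

∑ : {I : Set} → List I → (I → ℝ) → ℝ
∑ is g = foldr _+ᵣ_ 0ᵣ (map g is)

syntax ∑ is (λ i → e) = ∑[ i ∈ is ] e

IsInfimum : (ℝ → Set) → ℝ → Set
IsInfimum P v = (∀ s → P s → v ≤ᵣ s) × (∀ w → (∀ s → P s → w ≤ᵣ s) → w ≤ᵣ v)

------------------------------------------------------------------------
-- Finite simple graphs and subgraphs

record Graph : Set₁ where
  infix 4 _~_
  field
    V        : Set
    _≟_      : DecidableEquality V
    vertices : List V
    complete : ∀ v → v ∈ vertices
    unique   : Unique vertices
    _~_      : V → V → Set
    _~?_     : Decidable _~_
    ~-sym    : Symmetric _~_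
    ~-irrefl : Irreflexive _≡_ _~_

record Subgraph (G : Graph) : Set₁ where
  open Graph G
  infix 4 _~ₕ_
  field
    A     : V → Set
    A?    : Unary.Decidable A
    _~ₕ_  : V → V → Set
    _~ₕ?_ : Decidable _~ₕ_
    ~ₕ-sym : Symmetric _~ₕ_
    ~ₕ⇒~  : ∀ {u v} → u ~ₕ v → u ~ v
    ~ₕ⇒A  : ∀ {u v} → u ~ₕ v → A u × A v

module Retraction (G : Graph) (H : Subgraph G) where
  open Graph G
  open Subgraph H

  anchors : List V
  anchors = filter A? vertices

  -- Walk k u v: there is a walk of length k from u to v in H.
  Walk : ℕ → V → V → Set
  Walk zero    u v = u ≡ v
  Walk (suc k) u v = ∃ λ w → u ~ₕ w × Walk k w v

  walk? : ∀ k u v → Dec (Walk k u v)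
  walk? zero    u v = u ≟ v
  walk? (suc k) u v =
    map′ (λ p → let w , _ , q = find p in w , q)
         (λ (w , q) → lose (complete w) q)
         (any? (λ w → (u ~ₕ? w) ×-dec walk? k w v) vertices)

  -- The first k among start, …, start + fuel - 1 for which there is a walk of
  -- length k, and start + fuel if there is none.
  firstWalk : (fuel start : ℕ) → V → V → ℕ
  firstWalk zero       k u v = k
  firstWalk (suc fuel) k u v with walk? k u v
  ... | yes _ = k
  ... | no  _ = firstWalk fuel (suc k) u v

  -- A shortest walk visits no vertex twice, so its length is below the number
  -- of vertices and the bounded search finds it.  The value at pairs that are
  -- not connected in H is junk.
  d : V → V → ℕ
  d u v = firstWalk (length vertices) 0 u v

  private
    firstWalk-minimal : ∀ fuel k {l u v} → k ℕ.≤ l → l ℕ.≤ fuel ℕ.+ k →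
                        Walk l u v → firstWalk fuel k u v ℕ.≤ l
    firstWalk-minimal zero k k≤l _ _ = k≤l
    firstWalk-minimal (suc fuel) k {l} {u} {v} k≤l l≤ w with walk? k u v
    ... | yes _ = k≤l
    ... | no ¬w = firstWalk-minimal fuel (suc k)
            (ℕ.≤∧≢⇒< k≤l (λ { refl → ¬w w }))
            (subst (l ℕ.≤_) (sym (ℕ.+-suc fuel k)) l≤) w

    firstWalk-≤ : ∀ fuel k u v → firstWalk fuel k u v ℕ.≤ fuel ℕ.+ k
    firstWalk-≤ zero       k u v = ℕ.≤-refl
    firstWalk-≤ (suc fuel) k u v with walk? k u v
    ... | yes _ = ℕ.m≤n+m k (suc fuel)
    ... | no  _ = subst (firstWalk fuel (suc k) u v ℕ.≤_) (ℕ.+-suc fuel k)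
                        (firstWalk-≤ fuel (suc k) u v)

    firstWalk-walk : ∀ fuel k u v → firstWalk fuel k u v ℕ.< fuel ℕ.+ k →
                     Walk (firstWalk fuel k u v) u v
    firstWalk-walk zero       k u v lt = contradiction lt (ℕ.<-irrefl refl)
    firstWalk-walk (suc fuel) k u v lt with walk? k u v
    ... | yes w = w
    ... | no  _ = firstWalk-walk fuel (suc k) u v
                    (subst (firstWalk fuel (suc k) u v ℕ.<_) (sym (ℕ.+-suc fuel k)) lt)

  d-minimal : ∀ {k u v} → Walk k u v → d u v ℕ.≤ k
  d-minimal {k} {u} {v} w with ℕ.≤-total k (length vertices)
  ... | inj₁ k≤n = firstWalk-minimal (length vertices) 0 ℕ.z≤n
                     (subst (k ℕ.≤_) (sym (ℕ.+-identityʳ _)) k≤n) w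
  ... | inj₂ n≤k = ℕ.≤-trans (firstWalk-≤ (length vertices) 0 u v)
                     (subst (ℕ._≤ k) (sym (ℕ.+-identityʳ _)) n≤k)

  d-walk : ∀ {u v} → d u v ℕ.< length vertices → Walk (d u v) u v
  d-walk {u} {v} lt = firstWalk-walk (length vertices) 0 u v
                        (subst (d u v ℕ.<_) (sym (ℕ.+-identityʳ _)) lt)

  record IsRetraction (f : V → V) : Set where
    field
      into  : ∀ v → A (f v)
      fixes : ∀ v → A v → f v ≡ v

  edges : List (V × V)
  edges = filter (λ (u , v) → u ~? v) (cartesianProduct vertices vertices)

  stretch : (V → V) → ℕ
  stretch f = max 0 (map (λ (u , v) → d (f u) (f v)) edges)

  -- Entries of x and f at indices that are not anchors, or of f at pairs that
  -- are not edges, enter no constraint.  Each undirected edge is taken in both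
  -- orientations; transposing f u v gives an admissible choice for f v u.
  record Feasible (s : ℝ) (x : V → V → ℝ) (f : V → V → V → V → ℝ) : Set where
    field
      flow  : ∀ u v → u ~ v → ∀ j → A j →
              x u j -ᵣ x v j +ᵣ ∑[ i ∈ anchors ] (f u v i j -ᵣ f u v j i) ≈ᵣ 0ᵣ
      mass  : ∀ u → ∑[ j ∈ anchors ] x u j ≈ᵣ 1ᵣ
      cost  : ∀ u v → u ~ v →
              ∑[ i ∈ anchors ] ∑[ j ∈ anchors ] (ℕ→ℚ (d i j) · f u v i j) ≤ᵣ s
      fixed : ∀ a → A a → x a a ≈ᵣ 1ᵣ
      x≥0   : ∀ u j → A j → 0ᵣ ≤ᵣ x u j
      f≥0   : ∀ u v → u ~ v → ∀ i j → A i → A j → 0ᵣ ≤ᵣ f u v i j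

  FeasibleValue : ℝ → Set
  FeasibleValue s = ∃ λ x → ∃ λ f → Feasible s x f

  IsLPOptimum : ℝ → Set
  IsLPOptimum = IsInfimum FeasibleValue

  -- (minimum stretch of a retraction) / (LP optimum) ≥ α, division-free.
  IntegralityGap≥ : ℚ → Set
  IntegralityGap≥ α = ∀ v → IsLPOptimum v → ∀ f → IsRetraction f →
                      α · v ≤ᵣ fromℚ (ℕ→ℚ (stretch f))

------------------------------------------------------------------------
-- The grid; coordinates run over 0, …, m - 1 instead of 1, …, m.

module _ (m : ℕ) where

  Cell : Set
  Cell = Fin m × Fin m

  Adjacent : Cell → Cell → Set
  Adjacent (i , j) (k , l) =
      (∣ toℕ i - toℕ k ∣ ≡ 1 × j ≡ l)
    ⊎ (i ≡ k × ∣ toℕ j - toℕ l ∣ ≡ 1)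

  adjacent? : Decidable Adjacent
  adjacent? (i , j) (k , l) =
         ((∣ toℕ i - toℕ k ∣ ℕ.≟ 1) ×-dec (j Fin.≟ l))
    ⊎-dec ((i Fin.≟ k) ×-dec (∣ toℕ j - toℕ l ∣ ℕ.≟ 1))

  Adjacent-sym : Symmetric Adjacent
  Adjacent-sym {i , j} {k , l} (inj₁ (p , q)) =
    inj₁ (trans (ℕ.∣-∣-comm (toℕ k) (toℕ i)) p , sym q)
  Adjacent-sym {i , j} {k , l} (inj₂ (p , q)) =
    inj₂ (sym p , trans (ℕ.∣-∣-comm (toℕ l) (toℕ j)) q)

  Adjacent-irrefl : Irreflexive _≡_ Adjacent
  Adjacent-irrefl {i , j} refl (inj₁ (p , _)) with trans (sym (ℕ.∣n-n∣≡0 (toℕ i))) p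
  ... | ()
  Adjacent-irrefl {i , j} refl (inj₂ (_ , q)) with trans (sym (ℕ.∣n-n∣≡0 (toℕ j))) q
  ... | ()

  grid : Graph
  grid = record
    { V        = Cell
    ; _≟_      = ≡-dec Fin._≟_ Fin._≟_
    ; vertices = cartesianProduct (allFin m) (allFin m)
    ; complete = λ (i , j) → ∈-cartesianProduct⁺ (∈-allFin i) (∈-allFin j)
    ; unique   = cartesianProduct⁺ (allFin⁺ m) (allFin⁺ m)
    ; _~_      = Adjacent
    ; _~?_     = adjacent?
    ; ~-sym    = Adjacent-sym
    ; ~-irrefl = Adjacent-irrefl
    }

  Extreme : Fin m → Set
  Extreme i = toℕ i ≡ 0 ⊎ suc (toℕ i) ≡ m

  extreme? : Unary.Decidable Extreme
  extreme? i = (toℕ i ℕ.≟ 0) ⊎-dec (suc (toℕ i) ℕ.≟ m)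

  OnBoundary : Cell → Set
  OnBoundary (i , j) = Extreme i ⊎ Extreme j

  onBoundary? : Unary.Decidable OnBoundary
  onBoundary? (i , j) = extreme? i ⊎-dec extreme? j

  -- For m ≥ 3 the only grid edges between boundary vertices are those along
  -- the sides, so the induced subgraph is the boundary cycle.
  boundaryCycle : Subgraph grid
  boundaryCycle = record
    { A      = OnBoundary
    ; A?     = onBoundary?
    ; _~ₕ_   = λ u v → OnBoundary u × OnBoundary v × Adjacent u v
    ; _~ₕ?_  = λ u v → onBoundary? u ×-dec onBoundary? v ×-dec adjacent? u v
    ; ~ₕ-sym = λ (p , q , r) → q , p , Adjacent-sym r
    ; ~ₕ⇒~   = λ (_ , _ , r) → r
    ; ~ₕ⇒A   = λ (p , q , _) → p , q
    }

{-# OPTIONS --safe #-}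

-- Upper bound.  Write m = n + 1, so that the coordinates run over 0, …, n.
-- Row j of the grid is wrapped along the boundary in two ways, from (0 , j)
-- down, along the bottom and up to (n , j), and likewise over the top.  Both
-- maps are 3-Lipschitz, and x^{(i,j)} puts mass (n - j)/n on the first image of
-- (i , j) and j/n on the second.  This is a point mass on the boundary; moving
-- along an edge costs at most 3 for the motion of the two images, plus the
-- transfer of mass 1/n over a distance of at most 6n.
--
-- Lower bound.  If twice the stretch is below n, no unit square has images on
-- opposite sides of the boundary.  Label each cell by the side on which its
-- image lies: around every unit square the number of bottom-right edges is
-- then even, hence also around the whole boundary, where it is 1.

module Submission where

open import Defs
open import Data.Bool.Base using (Bool; true; false; _∨_; _xor_; if_then_else_)
import Data.Bool.Properties as Bool
open import Data.Empty using (⊥)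
open import Data.Fin.Base using (Fin; toℕ; fromℕ<)
open import Data.Fin.Patterns using (0F; 1F; 2F; 3F)
import Data.Fin.Properties as Fin
open import Data.Integer.Base as ℤ using (+_)
import Data.Integer.Properties as ℤ
open import Data.List.Base using (List; []; _∷_; map; foldr; length; allFin; tabulate; cartesianProduct)
import Data.List.Properties as List
open import Data.List.Extrema.Nat using (xs≤max)
open import Data.List.Membership.Propositional using (_∈_)
open import Data.List.Membership.Propositional.Properties using (∈-filter⁺; ∈-cartesianProduct⁺; ∈-map⁺)
open import Data.List.Relation.Unary.All as All using (All; []; _∷_)
open import Data.List.Relation.Unary.AllPairs using ([]; _∷_)
open import Data.List.Relation.Unary.Any using (here; there)
open import Data.List.Relation.Unary.Unique.Propositional using (Unique)
import Data.List.Relation.Unary.Unique.Propositional.Properties as Unique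
open import Data.Nat.Base as ℕ using (ℕ; zero; suc; _∸_; _⊓_; ∣_-_∣; z≤n; s≤s)
import Data.Nat.Properties as ℕ
import Data.Nat.Solver as ℕ-Solver
open import Data.Product using (∃; _×_; _,_; proj₁; proj₂)
open import Data.Rational.Base as ℚ using (ℚ; 0ℚ; 1ℚ)
import Data.Rational.Properties as ℚ
import Data.Rational.Solver as ℚ-Solver
import Data.Rational.Unnormalised.Base as ℚᵘ
import Data.Rational.Unnormalised.Properties as ℚᵘ
open import Data.Sum.Base using (_⊎_; inj₁; inj₂; [_,_]′)
open import Function.Base using (id)
open import Relation.Binary.Definitions using (DecidableEquality)
open import Relation.Binary.PropositionalEquality
open import Relation.Nullary using (Dec; yes; no; does; contradiction)
open import Relation.Nullary.Decidable using (dec-true; dec-false; from-yes; _→-dec_)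

-- The embedding of the naturals into ordered rational arithmetic.

ℕ→ℚᵘ : ∀ k → ℚ.toℚᵘ (ℕ→ℚ k) ℚᵘ.≃ ℚᵘ.mkℚᵘ (+ k) 0
ℕ→ℚᵘ k = ℚ.toℚᵘ-fromℚᵘ (ℚᵘ.mkℚᵘ (+ k) 0)

-- Rational addition normalises its result, so the identity is checked on unnormalised fractions,
-- where every denominator is 1.
ℕ→ℚ-+ : ∀ a b → ℕ→ℚ (a ℕ.+ b) ≡ ℕ→ℚ a ℚ.+ ℕ→ℚ b
ℕ→ℚ-+ a b = ℚ.toℚᵘ-injective (begin
  ℚ.toℚᵘ (ℕ→ℚ (a ℕ.+ b))                     ≈⟨ ℕ→ℚᵘ (a ℕ.+ b) ⟩
  ℚᵘ.mkℚᵘ (+ (a ℕ.+ b)) 0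
    ≈⟨ ℚᵘ.*≡* (cong (ℤ._* + 1) (cong₂ ℤ._+_ (ℤ.*-identityʳ (+ a)) (ℤ.*-identityʳ (+ b)))) ⟨
  ℚᵘ.mkℚᵘ (+ a) 0 ℚᵘ.+ ℚᵘ.mkℚᵘ (+ b) 0         ≈⟨ ℚᵘ.+-cong (ℕ→ℚᵘ a) (ℕ→ℚᵘ b) ⟨
  ℚ.toℚᵘ (ℕ→ℚ a) ℚᵘ.+ ℚ.toℚᵘ (ℕ→ℚ b)         ≈⟨ ℚ.toℚᵘ-homo-+ (ℕ→ℚ a) (ℕ→ℚ b) ⟨
  ℚ.toℚᵘ (ℕ→ℚ a ℚ.+ ℕ→ℚ b)                   ∎)
  where open ℚᵘ.≃-Reasoning

ℕ→ℚ-* : ∀ a b → ℕ→ℚ (a ℕ.* b) ≡ ℕ→ℚ a ℚ.* ℕ→ℚ b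
ℕ→ℚ-* zero    b = sym (ℚ.*-zeroˡ (ℕ→ℚ b))
ℕ→ℚ-* (suc a) b = begin
  ℕ→ℚ (b ℕ.+ a ℕ.* b)                  ≡⟨ ℕ→ℚ-+ b (a ℕ.* b) ⟩
  ℕ→ℚ b ℚ.+ ℕ→ℚ (a ℕ.* b)             ≡⟨ cong₂ ℚ._+_ (sym (ℚ.*-identityˡ (ℕ→ℚ b))) (ℕ→ℚ-* a b) ⟩
  1ℚ ℚ.* ℕ→ℚ b ℚ.+ ℕ→ℚ a ℚ.* ℕ→ℚ b    ≡⟨ ℚ.*-distribʳ-+ (ℕ→ℚ b) 1ℚ (ℕ→ℚ a) ⟨
  (1ℚ ℚ.+ ℕ→ℚ a) ℚ.* ℕ→ℚ b             ≡⟨ cong (ℚ._* ℕ→ℚ b) (ℕ→ℚ-+ 1 a) ⟨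
  ℕ→ℚ (suc a) ℚ.* ℕ→ℚ b                ∎
  where open ≡-Reasoning

ℕ→ℚ-nonNeg : ∀ k → ℚ.NonNegative (ℕ→ℚ k)
ℕ→ℚ-nonNeg k = ℚ.normalize-nonNeg k 1

0≤ℕ→ℚ : ∀ k → 0ℚ ℚ.≤ ℕ→ℚ k
0≤ℕ→ℚ k = ℚ.nonNegative⁻¹ (ℕ→ℚ k) {{ℕ→ℚ-nonNeg k}}

ℕ→ℚ-mono-≤ : ∀ {a b} → a ℕ.≤ b → ℕ→ℚ a ℚ.≤ ℕ→ℚ b
ℕ→ℚ-mono-≤ {a} {b} a≤b = begin
  ℕ→ℚ a                      ≡⟨ ℚ.+-identityʳ (ℕ→ℚ a) ⟨
  ℕ→ℚ a ℚ.+ 0ℚ               ≤⟨ ℚ.+-monoʳ-≤ (ℕ→ℚ a) (0≤ℕ→ℚ (b ℕ.∸ a)) ⟩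
  ℕ→ℚ a ℚ.+ ℕ→ℚ (b ℕ.∸ a)   ≡⟨ ℕ→ℚ-+ a (b ℕ.∸ a) ⟨
  ℕ→ℚ (a ℕ.+ (b ℕ.∸ a))      ≡⟨ cong ℕ→ℚ (ℕ.m+[n∸m]≡n a≤b) ⟩
  ℕ→ℚ b                      ∎
  where open ℚ.≤-Reasoning

0≤* : ∀ {p q} → 0ℚ ℚ.≤ p → 0ℚ ℚ.≤ q → 0ℚ ℚ.≤ p ℚ.* q
0≤* {p} {q} 0≤p 0≤q = ℚ.nonNegative⁻¹ (p ℚ.* q)
  {{ℚ.nonNeg*nonNeg⇒nonNeg p {{ℚ.nonNegative 0≤p}} q {{ℚ.nonNegative 0≤q}}}}

0≤+ : ∀ {p q} → 0ℚ ℚ.≤ p → 0ℚ ℚ.≤ q → 0ℚ ℚ.≤ p ℚ.+ q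
0≤+ = ℚ.+-mono-≤

-- _≤ᵣ_ on the underlying sequences, from which Agda can infer the arguments.
_≤ₛ_ : (x y : ℕ → ℚ) → Set
x ≤ₛ y = ∀ ε → 0ℚ ℚ.< ε → ∃ λ N → ∀ k → N ℕ.≤ k → x k ℚ.≤ y k ℚ.+ ε

pointwise⇒≤ₛ : ∀ {x y} → (∀ k → x k ℚ.≤ y k) → x ≤ₛ y
pointwise⇒≤ₛ {x} {y} x≤y ε 0<ε = 0 , λ k _ → begin
  x k          ≤⟨ x≤y k ⟩
  y k          ≡⟨ ℚ.+-identityʳ (y k) ⟨
  y k ℚ.+ 0ℚ   ≤⟨ ℚ.+-monoʳ-≤ (y k) (ℚ.<⇒≤ 0<ε) ⟩
  y k ℚ.+ ε    ∎
  where open ℚ.≤-Reasoning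

pointwise⇒≈ₛ : ∀ {x y} → (∀ k → x k ≡ y k) → x ≤ₛ y × y ≤ₛ x
pointwise⇒≈ₛ x≡y = pointwise⇒≤ₛ (λ k → ℚ.≤-reflexive (x≡y k)) ,
                   pointwise⇒≤ₛ (λ k → ℚ.≤-reflexive (sym (x≡y k)))

·-bound : ∀ α v p q → ℚ.Positive α → v ≤ᵣ fromℚ p → α ℚ.* p ℚ.≤ q → α · v ≤ᵣ fromℚ q
·-bound α v p q α>0 v≤p αp≤q ε 0<ε = proj₁ bound , λ k k≥ → begin
  α ℚ.* seq v k             ≤⟨ ℚ.*-monoˡ-≤-nonNeg α {{ℚ.pos⇒nonNeg α}} (proj₂ bound k k≥) ⟩
  α ℚ.* (p ℚ.+ δ)           ≡⟨ ℚ.*-distribˡ-+ α p δ ⟩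
  α ℚ.* p ℚ.+ α ℚ.* δ       ≡⟨ cong (α ℚ.* p ℚ.+_) (trans (sym (ℚ.*-assoc α (ℚ.1/ α) ε))
                                 (trans (cong (ℚ._* ε) (ℚ.*-inverseʳ α)) (ℚ.*-identityˡ ε))) ⟩
  α ℚ.* p ℚ.+ ε             ≤⟨ ℚ.+-monoˡ-≤ ε αp≤q ⟩
  q ℚ.+ ε                   ∎
  where
  open ℚ.≤-Reasoning
  instance
    α>0′ : ℚ.Positive α
    α>0′ = α>0
    α≢0 : ℚ.NonZero α
    α≢0 = ℚ.pos⇒nonZero α
  δ : ℚ
  -- Multiplication by `α` turns this tolerance into exactly `ε`.
  δ = ℚ.1/ α ℚ.* ε
  bound = v≤p δ (ℚ.positive⁻¹ δ {{ℚ.pos*pos⇒pos (ℚ.1/ α) {{ℚ.1/pos⇒pos α}} ε {{ℚ.positive 0<ε}}}})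

-- Finite sums of rationals

module _ {I : Set} where

  sum : List I → (I → ℚ) → ℚ
  sum is g = foldr ℚ._+_ 0ℚ (map g is)

  seq-∑ : ∀ (is : List I) (g : I → ℝ) k → seq (∑ is g) k ≡ sum is (λ i → seq (g i) k)
  seq-∑ []       g k = refl
  seq-∑ (i ∷ is) g k = cong (seq (g i) k ℚ.+_) (seq-∑ is g k)

  sum-cong : ∀ is {g h : I → ℚ} → (∀ i → g i ≡ h i) → sum is g ≡ sum is h
  sum-cong []       g≡h = refl
  sum-cong (i ∷ is) g≡h = cong₂ ℚ._+_ (g≡h i) (sum-cong is g≡h)

  sum-+ : ∀ is (g h : I → ℚ) → sum is (λ i → g i ℚ.+ h i) ≡ sum is g ℚ.+ sum is h
  sum-+ []       g h = refl
  sum-+ (i ∷ is) g h = trans (cong (g i ℚ.+ h i ℚ.+_) (sum-+ is g h))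
    (solve 4 (λ a b c d → a :+ b :+ (c :+ d) := a :+ c :+ (b :+ d)) refl
       (g i) (h i) (sum is g) (sum is h))
    where open ℚ-Solver.+-*-Solver

  sum-neg : ∀ is (g : I → ℚ) → sum is (λ i → ℚ.- g i) ≡ ℚ.- sum is g
  sum-neg []       g = refl
  sum-neg (i ∷ is) g = trans (cong (ℚ.- g i ℚ.+_) (sum-neg is g)) (sym (ℚ.neg-distrib-+ (g i) (sum is g)))

  module _ (_≟_ : DecidableEquality I) where

    δ : I → I → ℚ
    δ a i = if does (a ≟ i) then 1ℚ else 0ℚ

    δ-refl : ∀ a → δ a a ≡ 1ℚ
    δ-refl a = cong (if_then 1ℚ else 0ℚ) (dec-true (a ≟ a) refl)

    δ-≢ : ∀ {a i} → a ≢ i → δ a i ≡ 0ℚ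
    δ-≢ {a} {i} a≢i = cong (if_then 1ℚ else 0ℚ) (dec-false (a ≟ i) a≢i)

    0≤δ : ∀ a i → 0ℚ ℚ.≤ δ a i
    0≤δ a i with a ≟ i
    ... | yes _ = 0≤ℕ→ℚ 1
    ... | no  _ = 0≤ℕ→ℚ 0

    sum-δ-∉ : ∀ {is a} (h : I → ℚ) → All (a ≢_) is → sum is (λ i → δ a i ℚ.* h i) ≡ 0ℚ
    sum-δ-∉ h []              = refl
    sum-δ-∉ {i ∷ is} {a} h (a≢i ∷ a∉is) = cong₂ ℚ._+_
      (trans (cong (ℚ._* h i) (δ-≢ a≢i)) (ℚ.*-zeroˡ (h i))) (sum-δ-∉ h a∉is)

    -- Since the list has no repetitions, the point mass picks out `h a` exactly once.
    sum-δ : ∀ {is a} (h : I → ℚ) → Unique is → a ∈ is → sum is (λ i → δ a i ℚ.* h i) ≡ h a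
    sum-δ {i ∷ is} h (a∉is ∷ _) (here refl) = trans
      (cong₂ ℚ._+_ (trans (cong (ℚ._* h i) (δ-refl i)) (ℚ.*-identityˡ (h i))) (sum-δ-∉ h a∉is))
      (ℚ.+-identityʳ (h i))
    sum-δ {i ∷ is} {a} h (i∉is ∷ u) (there a∈is) = trans
      (cong₂ ℚ._+_ (trans (cong (ℚ._* h i) (δ-≢ λ a≡i → All.lookup i∉is a∈is (sym a≡i))) (ℚ.*-zeroˡ (h i)))
                   (sum-δ h u a∈is))
      (ℚ.+-identityˡ (h a))

-- Earthmover bounds for signed measures on the anchors

module Earthmover (G : Graph) (H : Subgraph G) where
  open Graph G
  open Subgraph H
  open Retraction G H

  δᵥ : V → V → ℚ
  δᵥ = δ _≟_

  sum-δᵥ : ∀ {a} (h : V → ℚ) → A a → sum anchors (λ i → δᵥ a i ℚ.* h i) ≡ h a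
  sum-δᵥ {a} h Aa = sum-δ _≟_ h (Unique.filter⁺ A? unique) (∈-filter⁺ A? (complete a) Aa)

  -- A flow need not be a coupling, so flows add up and the bounds are subadditive.
  -- Bounding the transposed flow as well makes them invariant under μ ↦ - μ
  -- without knowing that d is symmetric.
  record Transport (μ : V → ℚ) (s : ℚ) : Set where
    field
      flow   : V → V → ℚ
      flow≥0 : ∀ i j → 0ℚ ℚ.≤ flow i j
      net    : ∀ j → A j → μ j ℚ.+ sum anchors (λ i → flow i j ℚ.- flow j i) ≡ 0ℚ
      cost   : sum anchors (λ i → sum anchors λ j → ℕ→ℚ (d i j) ℚ.* flow i j) ℚ.≤ s
      costᵀ  : sum anchors (λ i → sum anchors λ j → ℕ→ℚ (d i j) ℚ.* flow j i) ℚ.≤ s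

  open Transport

  totalCost : (V → V → ℚ) → ℚ
  totalCost g = sum anchors (λ i → sum anchors λ j → ℕ→ℚ (d i j) ℚ.* g i j)

  totalCost-+ : ∀ g h → totalCost (λ i j → g i j ℚ.+ h i j) ≡ totalCost g ℚ.+ totalCost h
  totalCost-+ g h = trans
    (sum-cong anchors λ i → trans
      (sum-cong anchors λ j → ℚ.*-distribˡ-+ (ℕ→ℚ (d i j)) (g i j) (h i j))
      (sum-+ anchors _ _))
    (sum-+ anchors _ _)

  transport-+ : ∀ {μ ν s t} → Transport μ s → Transport ν t →
                Transport (λ j → μ j ℚ.+ ν j) (s ℚ.+ t)
  transport-+ {μ} {ν} {s} {t} T U = record
    { flow   = λ i j → flow T i j ℚ.+ flow U i j
    ; flow≥0 = λ i j → 0≤+ (flow≥0 T i j) (flow≥0 U i j)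
    ; net    = λ j Aj → begin
        μ j ℚ.+ ν j ℚ.+ sum anchors (λ i → flow T i j ℚ.+ flow U i j ℚ.- (flow T j i ℚ.+ flow U j i))
          ≡⟨ cong (μ j ℚ.+ ν j ℚ.+_) (trans
               (sum-cong anchors λ i → solve 4
                  (λ a b c e → a :+ b :- (c :+ e) := (a :- c) :+ (b :- e)) refl
                  (flow T i j) (flow U i j) (flow T j i) (flow U j i))
               (sum-+ anchors _ _)) ⟩
        μ j ℚ.+ ν j ℚ.+ (net₁ j ℚ.+ net₂ j)
          ≡⟨ solve 4 (λ a b c e → a :+ b :+ (c :+ e) := (a :+ c) :+ (b :+ e)) refl
               (μ j) (ν j) (net₁ j) (net₂ j) ⟩
        (μ j ℚ.+ net₁ j) ℚ.+ (ν j ℚ.+ net₂ j)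
          ≡⟨ cong₂ ℚ._+_ (net T j Aj) (net U j Aj) ⟩
        0ℚ ∎
    ; cost   = subst (ℚ._≤ s ℚ.+ t) (sym (totalCost-+ (flow T) (flow U)))
                 (ℚ.+-mono-≤ (cost T) (cost U))
    ; costᵀ  = subst (ℚ._≤ s ℚ.+ t) (sym (totalCost-+ (λ i j → flow T j i) (λ i j → flow U j i)))
                 (ℚ.+-mono-≤ (costᵀ T) (costᵀ U))
    }
    where
    open ≡-Reasoning
    open ℚ-Solver.+-*-Solver
    net₁ net₂ : V → ℚ
    net₁ j = sum anchors (λ i → flow T i j ℚ.- flow T j i)
    net₂ j = sum anchors (λ i → flow U i j ℚ.- flow U j i)

  transport-neg : ∀ {μ s} → Transport μ s → Transport (λ j → ℚ.- μ j) s
  transport-neg {μ} T = record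
    { flow   = λ i j → flow T j i
    ; flow≥0 = λ i j → flow≥0 T j i
    ; net    = λ j Aj → begin
        ℚ.- μ j ℚ.+ sum anchors (λ i → flow T j i ℚ.- flow T i j)
          ≡⟨ cong (ℚ.- μ j ℚ.+_) (trans
               (sum-cong anchors λ i → solve 2 (λ a b → a :- b := :- (b :- a)) refl (flow T j i) (flow T i j))
               (sum-neg anchors _)) ⟩
        ℚ.- μ j ℚ.+ ℚ.- sum anchors (λ i → flow T i j ℚ.- flow T j i)
          ≡⟨ sym (ℚ.neg-distrib-+ (μ j) _) ⟩
        ℚ.- (μ j ℚ.+ sum anchors (λ i → flow T i j ℚ.- flow T j i))
          ≡⟨ cong ℚ.-_ (net T j Aj) ⟩
        0ℚ ∎
    ; cost   = costᵀ T
    ; costᵀ  = cost T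
    }
    where
    open ≡-Reasoning
    open ℚ-Solver.+-*-Solver

  transport-resp : ∀ {μ ν s t} → (∀ j → μ j ≡ ν j) → s ℚ.≤ t → Transport μ s → Transport ν t
  transport-resp μ≡ν s≤t T = record
    { flow   = flow T
    ; flow≥0 = flow≥0 T
    ; net    = λ j Aj → trans (cong (ℚ._+ _) (sym (μ≡ν j))) (net T j Aj)
    ; cost   = ℚ.≤-trans (cost T) s≤t
    ; costᵀ  = ℚ.≤-trans (costᵀ T) s≤t
    }

  totalCost-atom : ∀ {a b} q → A a → A b →
                   totalCost (λ i j → q ℚ.* (δᵥ a i ℚ.* δᵥ b j)) ≡ q ℚ.* ℕ→ℚ (d a b)
  totalCost-atom {a} {b} q Aa Ab = begin
    totalCost (λ i j → q ℚ.* (δᵥ a i ℚ.* δᵥ b j))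
      ≡⟨ sum-cong anchors (λ i → trans
           (sum-cong anchors λ j → solve 4 (λ p e f g → p :* (e :* (f :* g)) := g :* (f :* (e :* p))) refl
              (ℕ→ℚ (d i j)) q (δᵥ a i) (δᵥ b j))
           (sum-δᵥ (λ j → δᵥ a i ℚ.* (q ℚ.* ℕ→ℚ (d i j))) Ab)) ⟩
    sum anchors (λ i → δᵥ a i ℚ.* (q ℚ.* ℕ→ℚ (d i b)))
      ≡⟨ sum-δᵥ (λ i → q ℚ.* ℕ→ℚ (d i b)) Aa ⟩
    q ℚ.* ℕ→ℚ (d a b) ∎
    where
    open ≡-Reasoning
    open ℚ-Solver.+-*-Solver

  -- All of `q` is put on the single pair `(a , b)`. The balance at `j` is a polynomial identity in
  -- the point masses, so `a ≡ b` needs no separate case. The reverse distance is bounded as well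
  -- because it is what `costᵀ` charges.
  transport-atom : ∀ {a b k q} → A a → A b → d a b ℕ.≤ k → d b a ℕ.≤ k → 0ℚ ℚ.≤ q →
                   Transport (λ j → q ℚ.* (δᵥ a j ℚ.- δᵥ b j)) (q ℚ.* ℕ→ℚ k)
  transport-atom {a} {b} {k} {q} Aa Ab dab≤k dba≤k 0≤q = record
    { flow   = λ i j → q ℚ.* (δᵥ a i ℚ.* δᵥ b j)
    ; flow≥0 = λ i j → 0≤* 0≤q (0≤* (0≤δ _≟_ a i) (0≤δ _≟_ b j))
    ; net    = λ j _ → begin
        q ℚ.* (δᵥ a j ℚ.- δᵥ b j) ℚ.+
          sum anchors (λ i → q ℚ.* (δᵥ a i ℚ.* δᵥ b j) ℚ.- q ℚ.* (δᵥ a j ℚ.* δᵥ b i))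
          ≡⟨ cong (q ℚ.* (δᵥ a j ℚ.- δᵥ b j) ℚ.+_) (trans
               (sum-cong anchors λ i → solve 5
                  (λ q ai bj aj bi → q :* (ai :* bj) :- q :* (aj :* bi) :=
                                     ai :* (q :* bj) :+ bi :* (:- (q :* aj))) refl
                  q (δᵥ a i) (δᵥ b j) (δᵥ a j) (δᵥ b i))
               (trans (sum-+ anchors _ _)
                 (cong₂ ℚ._+_ (sum-δᵥ (λ _ → q ℚ.* δᵥ b j) Aa) (sum-δᵥ (λ _ → ℚ.- (q ℚ.* δᵥ a j)) Ab)))) ⟩
        q ℚ.* (δᵥ a j ℚ.- δᵥ b j) ℚ.+ (q ℚ.* δᵥ b j ℚ.+ ℚ.- (q ℚ.* δᵥ a j))
          ≡⟨ solve 3 (λ q x y → q :* (x :- y) :+ (q :* y :+ :- (q :* x)) := con 0ℚ) refl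
               q (δᵥ a j) (δᵥ b j) ⟩
        0ℚ ∎
    ; cost   = subst (ℚ._≤ q ℚ.* ℕ→ℚ k) (sym (totalCost-atom q Aa Ab)) (bound dab≤k)
    ; costᵀ  = subst (ℚ._≤ q ℚ.* ℕ→ℚ k)
        (sym (trans
          (sum-cong anchors λ i → sum-cong anchors λ j →
            cong (λ e → ℕ→ℚ (d i j) ℚ.* (q ℚ.* e)) (ℚ.*-comm (δᵥ a j) (δᵥ b i)))
          (totalCost-atom q Ab Aa)))
        (bound dba≤k)
    }
    where
    open ≡-Reasoning
    open ℚ-Solver.+-*-Solver
    bound : ∀ {l} → l ℕ.≤ k → q ℚ.* ℕ→ℚ l ℚ.≤ q ℚ.* ℕ→ℚ k
    bound l≤k = ℚ.*-monoˡ-≤-nonNeg q {{ℚ.nonNegative 0≤q}} (ℕ→ℚ-mono-≤ l≤k)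

  module _ (x : V → V → ℚ) (s : ℚ)
           (mass  : ∀ u → sum anchors (x u) ≡ 1ℚ)
           (fixed : ∀ a → A a → x a a ≡ 1ℚ)
           (x≥0   : ∀ u j → 0ℚ ℚ.≤ x u j)
           (move  : ∀ {u v} → u ~ v → Transport (λ j → x u j ℚ.- x v j) s) where

    -- The LP variables are indexed by all pairs of vertices, whereas `move` expects an adjacency
    -- proof. The default 0 off the edges enters no constraint.
    edgeFlow : ∀ {u v} → Dec (u ~ v) → V → V → ℚ
    edgeFlow (yes u~v) = flow (move u~v)
    edgeFlow (no  _)   = λ _ _ → 0ℚ

    -- The decision may return a different adjacency proof from the one at hand, so the property is
    -- required of the flow of every such proof.
    edgeFlow-spec : ∀ {u v} (P : (V → V → ℚ) → Set) → (∀ u~v → P (flow (move u~v))) →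
                    (D : Dec (u ~ v)) → u ~ v → P (edgeFlow D)
    edgeFlow-spec P p (yes u~v) _   = p u~v
    edgeFlow-spec P p (no ¬u~v) u~v = contradiction u~v ¬u~v

    feasible : FeasibleValue (fromℚ s)
    feasible = (λ u j → fromℚ (x u j)) , (λ u v i j → fromℚ (edgeFlow (u ~? v) i j)) , record
      { flow  = λ u v u~v j Aj → edgeFlow-spec
          (λ g → fromℚ (x u j) -ᵣ fromℚ (x v j) +ᵣ
                 ∑[ i ∈ anchors ] (fromℚ (g i j) -ᵣ fromℚ (g j i)) ≈ᵣ 0ᵣ)
          (λ e → pointwise⇒≈ₛ λ k → trans
            (cong₂ ℚ._+_ (minus (x u j) (x v j)) (trans (seq-∑ anchors _ k)
              (sum-cong anchors λ i → minus (flow (move e) i j) (flow (move e) j i))))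
            (net (move e) j Aj))
          (u ~? v) u~v
      ; mass  = λ u → pointwise⇒≈ₛ λ k → trans (seq-∑ anchors _ k) (mass u)
      ; cost  = λ u v u~v → edgeFlow-spec
          (λ g → ∑[ i ∈ anchors ] ∑[ j ∈ anchors ] (ℕ→ℚ (d i j) · fromℚ (g i j)) ≤ᵣ fromℚ s)
          (λ e → pointwise⇒≤ₛ λ k → subst (ℚ._≤ s)
            (sym (trans (seq-∑ anchors _ k) (sum-cong anchors λ i → seq-∑ anchors _ k)))
            (cost (move e)))
          (u ~? v) u~v
      ; fixed = λ a Aa → pointwise⇒≈ₛ λ k → fixed a Aa
      ; x≥0   = λ u j _ → pointwise⇒≤ₛ λ k → x≥0 u j
      ; f≥0   = λ u v u~v i j _ _ → edgeFlow-spec (λ g → 0ᵣ ≤ᵣ fromℚ (g i j))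
          (λ e → pointwise⇒≤ₛ λ k → flow≥0 (move e) i j) (u ~? v) u~v
      }
      where
      minus : ∀ p q → p ℚ.+ (ℚ.- 1ℚ) ℚ.* q ≡ p ℚ.- q
      minus = solve 2 (λ p q → p :+ con (ℚ.- 1ℚ) :* q := p :- q) refl
        where open ℚ-Solver.+-*-Solver

-- Distributions interpolating between two maps to the anchors.

module Interpolation (G : Graph) (H : Subgraph G) (n k l : ℕ) .{{n-nonZero : ℕ.NonZero n}} where
  open Graph G
  open Subgraph H
  open Retraction G H
  open Earthmover G H

  instance
    n>0 : ℚ.Positive (ℕ→ℚ n)
    n>0 = ℚ.normalize-pos n 1

    n≢0 : ℚ.NonZero (ℕ→ℚ n)
    n≢0 = ℚ.pos⇒nonZero (ℕ→ℚ n)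

  infix 8 _/n

  _/n : ℕ → ℚ
  a /n = ℕ→ℚ a ℚ.* ℚ.1/ ℕ→ℚ n

  1/n≥0 : ℚ.NonNegative (ℚ.1/ ℕ→ℚ n)
  1/n≥0 = ℚ.pos⇒nonNeg (ℚ.1/ ℕ→ℚ n) {{ℚ.1/pos⇒pos (ℕ→ℚ n)}}

  0≤/n : ∀ a → 0ℚ ℚ.≤ a /n
  0≤/n a = 0≤* (0≤ℕ→ℚ a) (ℚ.nonNegative⁻¹ (ℚ.1/ ℕ→ℚ n) {{1/n≥0}})

  /n-mono : ∀ {a b} → a ℕ.≤ b → a /n ℚ.≤ b /n
  /n-mono a≤b = ℚ.*-monoʳ-≤-nonNeg (ℚ.1/ ℕ→ℚ n) {{1/n≥0}} (ℕ→ℚ-mono-≤ a≤b)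

  /n-+ : ∀ a b → (a ℕ.+ b) /n ≡ a /n ℚ.+ b /n
  /n-+ a b = trans (cong (ℚ._* ℚ.1/ ℕ→ℚ n) (ℕ→ℚ-+ a b)) (ℚ.*-distribʳ-+ (ℚ.1/ ℕ→ℚ n) (ℕ→ℚ a) (ℕ→ℚ b))

  /n-* : ∀ a b → a /n ℚ.* ℕ→ℚ b ≡ (a ℕ.* b) /n
  /n-* a b = trans
    (solve 3 (λ a w b → a :* w :* b := a :* b :* w) refl (ℕ→ℚ a) (ℚ.1/ ℕ→ℚ n) (ℕ→ℚ b))
    (cong (ℚ._* ℚ.1/ ℕ→ℚ n) (sym (ℕ→ℚ-* a b)))
    where open ℚ-Solver.+-*-Solver

  n*/n : ∀ a → (a ℕ.* n) /n ≡ ℕ→ℚ a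
  n*/n a = begin
    (a ℕ.* n) /n                              ≡⟨ cong (ℚ._* ℚ.1/ ℕ→ℚ n) (ℕ→ℚ-* a n) ⟩
    ℕ→ℚ a ℚ.* ℕ→ℚ n ℚ.* ℚ.1/ ℕ→ℚ n          ≡⟨ ℚ.*-assoc (ℕ→ℚ a) (ℕ→ℚ n) _ ⟩
    ℕ→ℚ a ℚ.* (ℕ→ℚ n ℚ.* ℚ.1/ ℕ→ℚ n)        ≡⟨ cong (ℕ→ℚ a ℚ.*_) (ℚ.*-inverseʳ (ℕ→ℚ n)) ⟩
    ℕ→ℚ a ℚ.* 1ℚ                              ≡⟨ ℚ.*-identityʳ (ℕ→ℚ a) ⟩
    ℕ→ℚ a                                      ∎
    where open ≡-Reasoning

  weights : ∀ {j} → j ℕ.≤ n → (n ∸ j) /n ℚ.+ j /n ≡ 1ℚ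
  weights {j} j≤n = begin
    (n ∸ j) /n ℚ.+ j /n     ≡⟨ /n-+ (n ∸ j) j ⟨
    (n ∸ j ℕ.+ j) /n         ≡⟨ cong _/n (trans (ℕ.m∸n+n≡m j≤n) (sym (ℕ.*-identityˡ n))) ⟩
    (1 ℕ.* n) /n             ≡⟨ n*/n 1 ⟩
    1ℚ                       ∎
    where open ≡-Reasoning

  -- Here `k` is the speed of both maps, and `l * n` bounds the distance between any two images
  -- under different maps. A unit change of height transfers mass 1/n over at most `l * n`, which
  -- costs `l`; the total is `k + l`. The condition `endpoints` says that at an anchor each image is
  -- the anchor itself or has weight 0, which makes the distribution there a point mass.
  module _ (height : V → ℕ) (lower upper : V → V)
      (height≤n  : ∀ u → height u ℕ.≤ n)
      (levels    : ∀ {u v} → u ~ v → height u ≡ height v ⊎ height v ≡ suc (height u) ⊎ height u ≡ suc (height v))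
      (lower∈A   : ∀ u → A (lower u))
      (upper∈A   : ∀ u → A (upper u))
      (endpoints : ∀ u → A u → (lower u ≡ u ⊎ n ∸ height u ≡ 0) × (upper u ≡ u ⊎ height u ≡ 0))
      (lower-lip : ∀ {u v} → u ~ v → d (lower u) (lower v) ℕ.≤ k)
      (upper-lip : ∀ {u v} → u ~ v → d (upper u) (upper v) ℕ.≤ k)
      (across    : ∀ u v → d (lower u) (upper v) ℕ.≤ l ℕ.* n × d (upper v) (lower u) ℕ.≤ l ℕ.* n)
    where

    x : V → V → ℚ
    x u a = (n ∸ height u) /n ℚ.* δᵥ (lower u) a ℚ.+ height u /n ℚ.* δᵥ (upper u) a

    sum-scaled-δᵥ : ∀ a q → A a → sum anchors (λ i → q ℚ.* δᵥ a i) ≡ q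
    sum-scaled-δᵥ a q b = trans (sum-cong anchors λ i → ℚ.*-comm q (δᵥ a i)) (sum-δᵥ (λ _ → q) b)

    x-mass : ∀ u → sum anchors (x u) ≡ 1ℚ
    x-mass u = trans (sum-+ anchors _ _)
      (trans (cong₂ ℚ._+_ (sum-scaled-δᵥ (lower u) ((n ∸ height u) /n) (lower∈A u))
                          (sum-scaled-δᵥ (upper u) (height u /n) (upper∈A u)))
             (weights (height≤n u)))

    x≥0 : ∀ u a → 0ℚ ℚ.≤ x u a
    x≥0 u a = 0≤+ (0≤* (0≤/n (n ∸ height u)) (0≤δ _≟_ (lower u) a)) (0≤* (0≤/n (height u)) (0≤δ _≟_ (upper u) a))

    x-fixed-by : ∀ u → lower u ≡ u ⊎ n ∸ height u ≡ 0 → upper u ≡ u ⊎ height u ≡ 0 → x u u ≡ 1ℚ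
    x-fixed-by u p q = trans (cong₂ ℚ._+_ (term p) (term q)) (weights (height≤n u))
      where
      term : ∀ {a l} → a ≡ u ⊎ l ≡ 0 → l /n ℚ.* δᵥ a u ≡ l /n
      term {l = l} (inj₁ refl) = trans (cong (l /n ℚ.*_) (δ-refl _≟_ u)) (ℚ.*-identityʳ (l /n))
      term {a} (inj₂ refl) = trans (cong (ℚ._* δᵥ a u) (n*/n 0)) (trans (ℚ.*-zeroˡ (δᵥ a u)) (sym (n*/n 0)))

    x-fixed : ∀ u → A u → x u u ≡ 1ℚ
    x-fixed u Au = x-fixed-by u (proj₁ (endpoints u Au)) (proj₂ (endpoints u Au))

    transport-scaled : ∀ {a b r} q → A a → A b → d a b ℕ.≤ r → d b a ℕ.≤ r →
                       Transport (λ j → q /n ℚ.* (δᵥ a j ℚ.- δᵥ b j)) ((q ℕ.* r) /n)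
    transport-scaled {r = r} q Aa Ab ab ba =
      transport-resp (λ _ → refl) (ℚ.≤-reflexive (/n-* q r)) (transport-atom Aa Ab ab ba (0≤/n q))

    -- Accounts for the mass that stays with the same map along the edge. The weights `p` and `q`
    -- are free because on an edge that changes height the common weights sum to less than `n`.
    slide : ∀ {u v} p q → u ~ v →
            Transport (λ j → p /n ℚ.* (δᵥ (lower u) j ℚ.- δᵥ (lower v) j) ℚ.+
                             q /n ℚ.* (δᵥ (upper u) j ℚ.- δᵥ (upper v) j)) (((p ℕ.+ q) ℕ.* k) /n)
    slide {u} {v} p q a = transport-resp (λ _ → refl)
      (ℚ.≤-reflexive (trans (sym (/n-+ (p ℕ.* k) (q ℕ.* k))) (cong _/n (sym (ℕ.*-distribʳ-+ k p q)))))
      (transport-+ (transport-scaled p (lower∈A u) (lower∈A v) (lower-lip a) (lower-lip (~-sym a)))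
                   (transport-scaled q (upper∈A u) (upper∈A v) (upper-lip a) (upper-lip (~-sym a))))

    move-level : ∀ {u v} → u ~ v → height u ≡ height v →
                 Transport (λ j → x u j ℚ.- x v j) (ℕ→ℚ (k ℕ.+ l))
    move-level {u} {v} a e = transport-resp
      (λ j → trans
        (solve 6 (λ p q b c b′ c′ → p :* (b :- b′) :+ q :* (c :- c′) :=
                                    (p :* b :+ q :* c) :- (p :* b′ :+ q :* c′)) refl
           ((n ∸ height u) /n) (height u /n) (δᵥ (lower u) j) (δᵥ (upper u) j) (δᵥ (lower v) j) (δᵥ (upper v) j))
        -- The identity above uses the weights of `u` for both vertices; equal heights make them
        -- those of `v`.
        (cong (λ h → x u j ℚ.- ((n ∸ h) /n ℚ.* δᵥ (lower v) j ℚ.+ h /n ℚ.* δᵥ (upper v) j)) e))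
      (begin
        ((n ∸ height u ℕ.+ height u) ℕ.* k) /n   ≡⟨ cong (λ l → (l ℕ.* k) /n) (ℕ.m∸n+n≡m (height≤n u)) ⟩
        (n ℕ.* k) /n                               ≡⟨ cong _/n (ℕ.*-comm n k) ⟩
        (k ℕ.* n) /n                               ≡⟨ n*/n k ⟩
        ℕ→ℚ k                                      ≤⟨ ℕ→ℚ-mono-≤ (ℕ.m≤m+n k l) ⟩
        ℕ→ℚ (k ℕ.+ l)                                      ∎)
      (slide (n ∸ height u) (height u) a)
      where
      open ℚ.≤-Reasoning
      open ℚ-Solver.+-*-Solver

    -- The lower images share the weight `n ∸ height v`, the upper images share `height u`, and
    -- these parts slide. Exactly 1/n is left over; it moves from `lower u` to `upper v`.
    move-up : ∀ {u v} → u ~ v → height v ≡ suc (height u) →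
              Transport (λ j → x u j ℚ.- x v j) (ℕ→ℚ (k ℕ.+ l))
    move-up {u} {v} a e = transport-resp
      (λ j → trans
        (solve 7 (λ p q w b c b′ c′ → p :* (b :- b′) :+ q :* (c :- c′) :+ w :* (b :- c′) :=
                                      ((p :+ w) :* b :+ q :* c) :- (p :* b′ :+ (q :+ w) :* c′)) refl
           (p /n) (q /n) (1 /n) (δᵥ (lower u) j) (δᵥ (upper u) j) (δᵥ (lower v) j) (δᵥ (upper v) j))
        (cong₂ (λ r s → (r ℚ.* δᵥ (lower u) j ℚ.+ q /n ℚ.* δᵥ (upper u) j) ℚ.-
                        (p /n ℚ.* δᵥ (lower v) j ℚ.+ s ℚ.* δᵥ (upper v) j))
          (trans (sym (/n-+ p 1)) (cong _/n p+1≡n∸q))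
          (trans (sym (/n-+ q 1)) (cong _/n (trans (ℕ.+-comm q 1) (sym e))))))
      (begin
        ((p ℕ.+ q) ℕ.* k) /n ℚ.+ (1 ℕ.* (l ℕ.* n)) /n
          ≡⟨ /n-+ ((p ℕ.+ q) ℕ.* k) (1 ℕ.* (l ℕ.* n)) ⟨
        ((p ℕ.+ q) ℕ.* k ℕ.+ 1 ℕ.* (l ℕ.* n)) /n
          ≤⟨ /n-mono (ℕ.+-mono-≤ (ℕ.*-monoˡ-≤ k p+q≤n) (ℕ.≤-reflexive (ℕ.*-identityˡ (l ℕ.* n)))) ⟩
        (n ℕ.* k ℕ.+ l ℕ.* n) /n
          ≡⟨ cong _/n (trans (cong (ℕ._+ l ℕ.* n) (ℕ.*-comm n k)) (sym (ℕ.*-distribʳ-+ n k l))) ⟩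
        ((k ℕ.+ l) ℕ.* n) /n
          ≡⟨ n*/n (k ℕ.+ l) ⟩
        ℕ→ℚ (k ℕ.+ l) ∎)
      (transport-+ (slide p q a)
        (transport-scaled 1 (lower∈A u) (upper∈A v) (proj₁ (across u v)) (proj₂ (across u v))))
      where
      open ℚ.≤-Reasoning
      open ℚ-Solver.+-*-Solver
      p q : ℕ
      p = n ∸ height v
      q = height u
      p+1≡n∸q : p ℕ.+ 1 ≡ n ∸ q
      -- The bound `height v ≤ n` keeps the truncated subtraction exact.
      p+1≡n∸q = trans (cong (λ h → n ∸ h ℕ.+ 1) e) (trans (ℕ.+-comm _ 1)
        (sym (ℕ.+-∸-assoc 1 (subst (ℕ._≤ n) e (height≤n v)))))
      p+q≤n : p ℕ.+ q ℕ.≤ n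
      p+q≤n = ℕ.≤-trans (ℕ.+-monoʳ-≤ p (ℕ.≤-trans (ℕ.n≤1+n q) (ℕ.≤-reflexive (sym e))))
                        (ℕ.≤-reflexive (ℕ.m∸n+n≡m (height≤n v)))

    move : ∀ {u v} → u ~ v → Transport (λ j → x u j ℚ.- x v j) (ℕ→ℚ (k ℕ.+ l))
    move {u} {v} a with levels a
    ... | inj₁ same          = move-level a same
    ... | inj₂ (inj₁ v≡1+u) = move-up a v≡1+u
    -- A downward edge is the reversed upward edge with its signed measure negated.
    ... | inj₂ (inj₂ u≡1+v) = transport-resp
      (λ w → solve 2 (λ p q → :- (p :- q) := q :- p) refl (x v w) (x u w)) ℚ.≤-refl
      (transport-neg (move-up (~-sym a) u≡1+v))
      where open ℚ-Solver.+-*-Solver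

    interpolation-feasible : FeasibleValue (fromℚ (ℕ→ℚ (k ℕ.+ l)))
    interpolation-feasible = feasible x (ℕ→ℚ (k ℕ.+ l)) x-mass x-fixed x≥0 move

-- Lipschitz bounds for addition, truncated subtraction and minimum.

∣∣-+ : ∀ a b c d → ∣ a ℕ.+ b - c ℕ.+ d ∣ ℕ.≤ ∣ a - c ∣ ℕ.+ ∣ b - d ∣
∣∣-+ a b c d = begin
  ∣ a ℕ.+ b - c ℕ.+ d ∣
    ≤⟨ ℕ.∣-∣-triangle (a ℕ.+ b) (c ℕ.+ b) (c ℕ.+ d) ⟩
  ∣ a ℕ.+ b - c ℕ.+ b ∣ ℕ.+ ∣ c ℕ.+ b - c ℕ.+ d ∣
    ≡⟨ cong₂ ℕ._+_ (trans (cong₂ ∣_-_∣ (ℕ.+-comm a b) (ℕ.+-comm c b)) (ℕ.∣m+n-m+o∣≡∣n-o∣ b a c))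
                   (ℕ.∣m+n-m+o∣≡∣n-o∣ c b d) ⟩
  ∣ a - c ∣ ℕ.+ ∣ b - d ∣ ∎
  where open ℕ.≤-Reasoning

∣∣-∸ˡ : ∀ a c b → ∣ a ∸ b - c ∸ b ∣ ℕ.≤ ∣ a - c ∣
∣∣-∸ˡ a       c       zero    = ℕ.≤-refl
∣∣-∸ˡ zero    c       (suc b) = ℕ.m∸n≤m c (suc b)
∣∣-∸ˡ (suc a) zero    (suc b) = ℕ.≤-trans (ℕ.≤-reflexive (ℕ.∣-∣-identityʳ (a ∸ b))) (ℕ.≤-trans (ℕ.m∸n≤m a b) (ℕ.n≤1+n a))
∣∣-∸ˡ (suc a) (suc c) (suc b) = ∣∣-∸ˡ a c b

∣m-m∸n∣≤n : ∀ m n → ∣ m - m ∸ n ∣ ℕ.≤ n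
∣m-m∸n∣≤n m n = ℕ.≤-trans (ℕ.≤-reflexive (ℕ.m≤n⇒∣n-m∣≡n∸m (ℕ.m∸n≤m m n)))
  (ℕ.m≤n+o⇒m∸n≤o m (m ∸ n) (ℕ.≤-trans (ℕ.m≤n+m∸n m n) (ℕ.≤-reflexive (ℕ.+-comm n (m ∸ n)))))

∣∣-∸ʳ : ∀ m b d → ∣ m ∸ b - m ∸ d ∣ ℕ.≤ ∣ b - d ∣
∣∣-∸ʳ m       zero    d       = ∣m-m∸n∣≤n m d
∣∣-∸ʳ m       (suc b) zero    = subst (ℕ._≤ suc b) (ℕ.∣-∣-comm m (m ∸ suc b)) (∣m-m∸n∣≤n m (suc b))
∣∣-∸ʳ zero    (suc b) (suc d) = z≤n
∣∣-∸ʳ (suc m) (suc b) (suc d) = ∣∣-∸ʳ m b d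

∣∣-∸ : ∀ a b c d → ∣ a ∸ b - c ∸ d ∣ ℕ.≤ ∣ a - c ∣ ℕ.+ ∣ b - d ∣
∣∣-∸ a b c d = ℕ.≤-trans (ℕ.∣-∣-triangle (a ∸ b) (c ∸ b) (c ∸ d))
                         (ℕ.+-mono-≤ (∣∣-∸ˡ a c b) (∣∣-∸ʳ c b d))

∣∣-⊓ : ∀ a c n → ∣ a ⊓ n - c ⊓ n ∣ ℕ.≤ ∣ a - c ∣
∣∣-⊓ zero    c       n       = ℕ.m⊓n≤m c n
∣∣-⊓ (suc a) zero    n       = ℕ.≤-trans (ℕ.≤-reflexive (ℕ.∣-∣-identityʳ (suc a ⊓ n))) (ℕ.m⊓n≤m (suc a) n)
∣∣-⊓ (suc a) (suc c) zero    = z≤n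
∣∣-⊓ (suc a) (suc c) (suc n) = ∣∣-⊓ a c n

∣∣-suc : ∀ a → ∣ a - suc a ∣ ≡ 1
∣∣-suc zero    = refl
∣∣-suc (suc a) = ∣∣-suc a

≤1⇒≡0⊎≡1 : ∀ {k} → k ℕ.≤ 1 → k ≡ 0 ⊎ k ≡ 1
≤1⇒≡0⊎≡1 z≤n       = inj₁ refl
≤1⇒≡0⊎≡1 (s≤s z≤n) = inj₂ refl

∣∣≡1⇒suc : ∀ a b → ∣ a - b ∣ ≡ 1 → b ≡ suc a ⊎ a ≡ suc b
∣∣≡1⇒suc zero    b       e = inj₁ e
∣∣≡1⇒suc (suc a) zero    e = inj₂ e
∣∣≡1⇒suc (suc a) (suc b) e with ∣∣≡1⇒suc a b e
... | inj₁ p = inj₁ (cong suc p)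
... | inj₂ p = inj₂ (cong suc p)

-- Paths along the boundary of the grid and the LP solution.

module Grid (n : ℕ) where

  open Retraction (grid (suc n)) (boundaryCycle (suc n))

  -- Total on the naturals, so that paths and labellings can be given by arithmetic formulas without
  -- range proofs; coordinates beyond `n` collapse to `n`.
  clamp : ℕ → Fin (suc n)
  clamp x = fromℕ< (s≤s (ℕ.m⊓n≤n x n))

  toℕ-clamp : ∀ x → toℕ (clamp x) ≡ x ⊓ n
  toℕ-clamp x = Fin.toℕ-fromℕ< _

  toℕ-clamp-≤ : ∀ {x} → x ℕ.≤ n → toℕ (clamp x) ≡ x
  toℕ-clamp-≤ {x} x≤n = trans (toℕ-clamp x) (ℕ.m≤n⇒m⊓n≡m x≤n)

  clamp-toℕ : ∀ i → clamp (toℕ i) ≡ i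
  clamp-toℕ i = Fin.toℕ-injective (toℕ-clamp-≤ (Fin.toℕ≤pred[n] i))

  cell : ℕ → ℕ → Cell (suc n)
  cell x y = clamp x , clamp y

  extreme-0 : Extreme (suc n) (clamp 0)
  extreme-0 = inj₁ (toℕ-clamp 0)

  extreme-n : Extreme (suc n) (clamp n)
  extreme-n = inj₂ (cong suc (toℕ-clamp-≤ ℕ.≤-refl))

  Boundary : Cell (suc n) → Set
  Boundary = OnBoundary (suc n)

  -- Bounded walks in both directions concatenate and reverse directly; `d` is bounded only at the
  -- end, which avoids its symmetry and triangle inequality.
  Close : ℕ → Cell (suc n) → Cell (suc n) → Set
  Close k u v = ∃ λ l → l ℕ.≤ k × Walk l u v × Walk l v u

  walk-++ : ∀ k {l u v w} → Walk k u v → Walk l v w → Walk (k ℕ.+ l) u w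
  walk-++ zero    refl        q = q
  walk-++ (suc k) (x , e , p) q = x , e , walk-++ k p q

  close-refl : ∀ {k u} → Close k u u
  close-refl = 0 , z≤n , refl , refl

  close-sym : ∀ {k u v} → Close k u v → Close k v u
  close-sym (l , l≤k , p , q) = l , l≤k , q , p

  close-mono : ∀ {k k′ u v} → k ℕ.≤ k′ → Close k u v → Close k′ u v
  close-mono k≤k′ (l , l≤k , p , q) = l , ℕ.≤-trans l≤k k≤k′ , p , q

  close-trans : ∀ {k l u v w} → Close k u v → Close l v w → Close (k ℕ.+ l) u w
  close-trans {u = u} {w = w} (k′ , k′≤k , p , p′) (l′ , l′≤l , q , q′) =
    k′ ℕ.+ l′ , ℕ.+-mono-≤ k′≤k l′≤l , walk-++ k′ p q ,
    subst (λ r → Walk r w u) (ℕ.+-comm l′ k′) (walk-++ l′ q′ p′)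

  close⇒d : ∀ {k u v} → Close k u v → d u v ℕ.≤ k × d v u ℕ.≤ k
  close⇒d (_ , l≤k , p , q) = ℕ.≤-trans (d-minimal p) l≤k , ℕ.≤-trans (d-minimal q) l≤k

  close-adjacent : ∀ {u v} → Boundary u → Boundary v → Adjacent (suc n) u v → Close 1 u v
  close-adjacent {u} {v} bu bv a =
    1 , ℕ.≤-refl , (v , (bu , bv , a) , refl) , (u , (bv , bu , Adjacent-sym (suc n) a) , refl)

  -- Clamping is 1-Lipschitz but can merge neighbours, so a step may become stationary.
  clamp-≤1 : ∀ {x x′} → ∣ x - x′ ∣ ℕ.≤ 1 →
             clamp x ≡ clamp x′ ⊎ ∣ toℕ (clamp x) - toℕ (clamp x′) ∣ ≡ 1
  clamp-≤1 {x} {x′} ≤1 with ≤1⇒≡0⊎≡1 (ℕ.≤-trans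
    (ℕ.≤-reflexive (cong₂ ∣_-_∣ (toℕ-clamp x) (toℕ-clamp x′))) (ℕ.≤-trans (∣∣-⊓ x x′ n) ≤1))
  ... | inj₁ ≡0 = inj₁ (Fin.toℕ-injective (ℕ.∣m-n∣≡0⇒m≡n ≡0))
  ... | inj₂ ≡1 = inj₂ ≡1

  close-cell : ∀ {x y x′ y′} → Boundary (cell x y) → Boundary (cell x′ y′) →
               (x ≡ x′ × ∣ y - y′ ∣ ℕ.≤ 1) ⊎ (∣ x - x′ ∣ ℕ.≤ 1 × y ≡ y′) →
               Close 1 (cell x y) (cell x′ y′)
  close-cell {x} {y} {x′} {y′} b b′ (inj₁ (refl , ≤1)) with clamp-≤1 {y} {y′} ≤1
  ... | inj₁ e  = subst (λ z → Close 1 (cell x y) (clamp x , z)) e close-refl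
  ... | inj₂ ≡1 = close-adjacent b b′ (inj₂ (refl , ≡1))
  close-cell {x} {y} {x′} {y′} b b′ (inj₂ (≤1 , refl)) with clamp-≤1 {x} {x′} ≤1
  ... | inj₁ e  = subst (λ z → Close 1 (cell x y) (z , clamp y)) e close-refl
  ... | inj₂ ≡1 = close-adjacent b b′ (inj₁ (≡1 , refl))

  -- The path down the left side, along the bottom and up the right side has
  -- its a-th vertex at (X a , Y a).
  X Y : ℕ → ℕ
  X a = (a ∸ n) ⊓ n
  Y a = (n ∸ a) ℕ.+ (a ∸ (n ℕ.+ n))

  X-left : ∀ {a} → a ℕ.≤ n → X a ≡ 0
  X-left a≤n = cong (_⊓ n) (ℕ.m≤n⇒m∸n≡0 a≤n)

  Y-left : ∀ {a} → a ℕ.≤ n → Y a ≡ n ∸ a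
  Y-left {a} a≤n = trans (cong (n ∸ a ℕ.+_) (ℕ.m≤n⇒m∸n≡0 (ℕ.≤-trans a≤n (ℕ.m≤m+n n n))))
                         (ℕ.+-identityʳ (n ∸ a))

  Y-base : ∀ {a} → n ℕ.≤ a → a ℕ.≤ n ℕ.+ n → Y a ≡ 0
  Y-base n≤a a≤2n = cong₂ ℕ._+_ (ℕ.m≤n⇒m∸n≡0 n≤a) (ℕ.m≤n⇒m∸n≡0 a≤2n)

  X-right : ∀ {a} → n ℕ.+ n ℕ.≤ a → X a ≡ n
  X-right {a} 2n≤a = ℕ.m≥n⇒m⊓n≡n (ℕ.m+n≤o⇒m≤o∸n n 2n≤a)

  Y-right : ∀ {a} → n ℕ.+ n ℕ.≤ a → Y a ≡ a ∸ (n ℕ.+ n)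
  Y-right {a} 2n≤a = cong (ℕ._+ (a ∸ (n ℕ.+ n))) (ℕ.m≤n⇒m∸n≡0 (ℕ.≤-trans (ℕ.m≤m+n n n) 2n≤a))

  -- φ is the identity, or the reflection y ↦ n - y which turns the path
  -- upside down.
  module UPath (φ : ℕ → ℕ) (φ-lip : ∀ y y′ → ∣ φ y - φ y′ ∣ ℕ.≤ ∣ y - y′ ∣)
               (φ-0 : Extreme (suc n) (clamp (φ 0))) where

    U : ℕ → Cell (suc n)
    U a = cell (X a) (φ (Y a))

    -- Comparison with `n` and `n + n` separates the three stretches: abscissa 0, ordinate `φ 0`,
    -- abscissa `n`. The last one covers all larger parameters too.
    U-boundary : ∀ a → Boundary (U a)
    U-boundary a with ℕ.≤-total a n | ℕ.≤-total a (n ℕ.+ n)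
    ... | inj₁ a≤n | _ = inj₁ (subst (λ x → Extreme (suc n) (clamp x)) (sym (X-left a≤n)) extreme-0)
    ... | inj₂ n≤a | inj₁ a≤2n =
      inj₂ (subst (λ y → Extreme (suc n) (clamp (φ y))) (sym (Y-base n≤a a≤2n)) φ-0)
    ... | inj₂ n≤a | inj₂ 2n≤a =
      inj₁ (subst (λ x → Extreme (suc n) (clamp x)) (sym (X-right 2n≤a)) extreme-n)

    -- The strict comparisons put `a` and `suc a` on the same stretch, where one coordinate is
    -- constant and the other changes by at most 1.
    close-suc : ∀ a → Close 1 (U a) (U (suc a))
    close-suc a = close-cell (U-boundary a) (U-boundary (suc a)) (step (a ℕ.<? n) (a ℕ.<? n ℕ.+ n))
      where
      φ-step : ∀ {y y′} → ∣ y - y′ ∣ ℕ.≤ 1 → ∣ φ y - φ y′ ∣ ℕ.≤ 1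
      φ-step = ℕ.≤-trans (φ-lip _ _)
      1≤1 : ∣ a - suc a ∣ ℕ.≤ 1
      1≤1 = ℕ.≤-reflexive (∣∣-suc a)
      step : _ → _ → _
      step (yes a<n) _ = inj₁
        ( trans (X-left (ℕ.<⇒≤ a<n)) (sym (X-left a<n))
        , φ-step (subst₂ (λ y y′ → ∣ y - y′ ∣ ℕ.≤ 1) (sym (Y-left (ℕ.<⇒≤ a<n))) (sym (Y-left a<n))
            (ℕ.≤-trans (∣∣-∸ʳ n a (suc a)) 1≤1)))
      step (no a≮n) (yes a<2n) = inj₂
        ( ℕ.≤-trans (∣∣-⊓ (a ∸ n) (suc a ∸ n) n) (ℕ.≤-trans (∣∣-∸ˡ a (suc a) n) 1≤1)
        , cong φ (trans (Y-base n≤a (ℕ.<⇒≤ a<2n)) (sym (Y-base (ℕ.m≤n⇒m≤1+n n≤a) a<2n))))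
        where n≤a = ℕ.≮⇒≥ a≮n
      step (no _) (no a≮2n) = inj₁
        ( trans (X-right 2n≤a) (sym (X-right (ℕ.m≤n⇒m≤1+n 2n≤a)))
        , φ-step (subst₂ (λ y y′ → ∣ y - y′ ∣ ℕ.≤ 1) (sym (Y-right 2n≤a))
            (sym (Y-right (ℕ.m≤n⇒m≤1+n 2n≤a)))
            (ℕ.≤-trans (∣∣-∸ˡ a (suc a) (n ℕ.+ n)) 1≤1)))
        where 2n≤a = ℕ.≮⇒≥ a≮2n

    close-+ : ∀ a k → Close k (U a) (U (k ℕ.+ a))
    close-+ a zero    = close-refl
    close-+ a (suc k) = subst (λ l → Close l (U a) (U (suc k ℕ.+ a))) (ℕ.+-comm k 1)
                          (close-trans (close-+ a k) (close-suc (k ℕ.+ a)))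

    close : ∀ a b → Close ∣ a - b ∣ (U a) (U b)
    close a b with ℕ.≤-total a b
    ... | inj₁ a≤b = subst₂ (λ k c → Close k (U a) (U c))
                       (sym (ℕ.m≤n⇒∣m-n∣≡n∸m a≤b)) (ℕ.m∸n+n≡m a≤b) (close-+ a (b ∸ a))
    ... | inj₂ b≤a = close-sym (subst₂ (λ k c → Close k (U b) (U c))
                       (sym (ℕ.m≤n⇒∣n-m∣≡n∸m b≤a)) (ℕ.m∸n+n≡m b≤a) (close-+ b (a ∸ b)))

  module Lower = UPath id (λ _ _ → ℕ.≤-refl) extreme-0
  module Upper = UPath (n ∸_) (∣∣-∸ʳ n) extreme-n

  -- param i j parametrises row j, from (0 , j) via the bottom to (n , j), with
  -- bounded speed; for j = 0 it is the bottom side itself.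
  param : ℕ → ℕ → ℕ
  param i j = (n ℕ.+ i ∸ (j ∸ i)) ℕ.+ (j ∸ (n ∸ i))

  -- Every operation in `param` is 1-Lipschitz in each argument; `i` occurs three times and `j`
  -- twice.
  param-lip : ∀ i j i′ j′ → ∣ param i j - param i′ j′ ∣ ℕ.≤ 3 ℕ.* ∣ i - i′ ∣ ℕ.+ 2 ℕ.* ∣ j - j′ ∣
  param-lip i j i′ j′ = begin
    ∣ param i j - param i′ j′ ∣
      ≤⟨ ∣∣-+ (n ℕ.+ i ∸ (j ∸ i)) _ (n ℕ.+ i′ ∸ (j′ ∸ i′)) _ ⟩
    ∣ n ℕ.+ i ∸ (j ∸ i) - n ℕ.+ i′ ∸ (j′ ∸ i′) ∣ ℕ.+ ∣ j ∸ (n ∸ i) - j′ ∸ (n ∸ i′) ∣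
      ≤⟨ ℕ.+-mono-≤
           (ℕ.≤-trans (∣∣-∸ (n ℕ.+ i) (j ∸ i) (n ℕ.+ i′) (j′ ∸ i′))
             (ℕ.+-mono-≤ (ℕ.≤-reflexive (ℕ.∣m+n-m+o∣≡∣n-o∣ n i i′)) (∣∣-∸ j i j′ i′)))
           (ℕ.≤-trans (∣∣-∸ j (n ∸ i) j′ (n ∸ i′)) (ℕ.+-monoʳ-≤ y (∣∣-∸ʳ n i i′))) ⟩
    (x ℕ.+ (y ℕ.+ x)) ℕ.+ (y ℕ.+ x)
      ≡⟨ solve 2 (λ x y → (x :+ (y :+ x)) :+ (y :+ x) := con 3 :* x :+ con 2 :* y) refl x y ⟩
    3 ℕ.* x ℕ.+ 2 ℕ.* y ∎
    where
    open ℕ.≤-Reasoning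
    open ℕ-Solver.+-*-Solver
    x = ∣ i - i′ ∣
    y = ∣ j - j′ ∣

  param-≤ : ∀ {i j} → i ℕ.≤ n → j ℕ.≤ n → param i j ℕ.≤ 3 ℕ.* n
  param-≤ {i} {j} i≤n j≤n = begin
    param i j              ≤⟨ ℕ.+-mono-≤ (ℕ.m∸n≤m (n ℕ.+ i) (j ∸ i)) (ℕ.m∸n≤m j (n ∸ i)) ⟩
    n ℕ.+ i ℕ.+ j          ≤⟨ ℕ.+-mono-≤ (ℕ.+-monoʳ-≤ n i≤n) j≤n ⟩
    n ℕ.+ n ℕ.+ n          ≡⟨ solve 1 (λ n → n :+ n :+ n := con 3 :* n) refl n ⟩
    3 ℕ.* n                ∎
    where
    open ℕ.≤-Reasoning
    open ℕ-Solver.+-*-Solver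

  -- For `upper` the whole picture is reflected: row `j` counts as row `n ∸ j`, and the path is the
  -- reflected one.
  lower upper : Cell (suc n) → Cell (suc n)
  lower (i , j) = Lower.U (param (toℕ i) (toℕ j))
  upper (i , j) = Upper.U (param (toℕ i) (n ∸ toℕ j))

  lower-boundary : ∀ u → Boundary (lower u)
  lower-boundary (i , j) = Lower.U-boundary (param (toℕ i) (toℕ j))

  upper-boundary : ∀ u → Boundary (upper u)
  upper-boundary (i , j) = Upper.U-boundary (param (toℕ i) (n ∸ toℕ j))

  coordinates-≤3 : ∀ {i j k l} → Adjacent (suc n) (i , j) (k , l) →
                   3 ℕ.* ∣ toℕ i - toℕ k ∣ ℕ.+ 2 ℕ.* ∣ toℕ j - toℕ l ∣ ℕ.≤ 3
  coordinates-≤3 {j = j} (inj₁ (e , refl)) rewrite e | ℕ.∣n-n∣≡0 (toℕ j) = ℕ.≤-refl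
  coordinates-≤3 {i = i} (inj₂ (refl , e)) rewrite e | ℕ.∣n-n∣≡0 (toℕ i) = ℕ.n≤1+n 2

  lower-close : ∀ {u v} → Adjacent (suc n) u v → Close 3 (lower u) (lower v)
  lower-close {i , j} {k , l} a = close-mono
    (ℕ.≤-trans (param-lip (toℕ i) (toℕ j) (toℕ k) (toℕ l)) (coordinates-≤3 a))
    (Lower.close _ _)

  upper-close : ∀ {u v} → Adjacent (suc n) u v → Close 3 (upper u) (upper v)
  upper-close {i , j} {k , l} a = close-mono
    (ℕ.≤-trans (param-lip (toℕ i) (n ∸ toℕ j) (toℕ k) (n ∸ toℕ l))
      (ℕ.≤-trans (ℕ.+-monoʳ-≤ (3 ℕ.* ∣ toℕ i - toℕ k ∣) (ℕ.*-monoʳ-≤ 2 (∣∣-∸ʳ n (toℕ j) (toℕ l))))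
                 (coordinates-≤3 a)))
    (Upper.close _ _)

  -- The two paths meet at the corner (0 , 0), which has parameter `n` on the lower and 0 on the
  -- upper one. Parameters are at most `3 * n`, so each half of the detour has length at most
  -- `3 * n`.
  lower-upper-close : ∀ u v → Close (6 ℕ.* n) (lower u) (upper v)
  lower-upper-close (i , j) (k , l) = close-mono
    (ℕ.≤-trans
      (ℕ.+-mono-≤
        (ℕ.≤-trans (ℕ.∣m-n∣≤m⊔n a n) (ℕ.⊔-lub a≤3n (ℕ.m≤n*m n 3)))
        (param-≤ (Fin.toℕ≤pred[n] k) (ℕ.m∸n≤m n (toℕ l))))
      (ℕ.≤-reflexive (sym (ℕ.*-distribʳ-+ n 3 3))))
    (close-trans (Lower.close a n)
      (subst (λ c → Close b c (Upper.U b)) (sym corner) (Upper.close 0 b)))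
    where
    a = param (toℕ i) (toℕ j)
    b = param (toℕ k) (n ∸ toℕ l)
    a≤3n = param-≤ (Fin.toℕ≤pred[n] i) (Fin.toℕ≤pred[n] j)
    corner : Lower.U n ≡ Upper.U 0
    corner = cong₂ cell (trans (X-left ℕ.≤-refl) (sym (X-left z≤n)))
      (trans (trans (Y-left ℕ.≤-refl) (ℕ.n∸n≡0 n)) (sym (trans (cong (n ∸_) (Y-left z≤n)) (ℕ.n∸n≡0 n))))

  -- Stated before clamping and reflection, so that it serves `lower` with row `j` and `upper` with
  -- row `n ∸ j`.
  Through : ℕ → ℕ → Set
  Through i j = X (param i j) ≡ i × Y (param i j) ≡ j

  -- On the path itself `param` is arc length: `n ∸ j` on the left side, `n + n + j` on the right
  -- side and `n + i` along the base.
  through-left : ∀ {j} → j ℕ.≤ n → Through 0 j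
  through-left {j} j≤n = trans (cong X e) (X-left (ℕ.m∸n≤m n j)) ,
                   trans (cong Y e) (trans (Y-left (ℕ.m∸n≤m n j)) (ℕ.m∸[m∸n]≡n j≤n))
    where
    e : param 0 j ≡ n ∸ j
    e = trans (cong₂ ℕ._+_ (cong (_∸ j) (ℕ.+-identityʳ n)) (ℕ.m≤n⇒m∸n≡0 j≤n)) (ℕ.+-identityʳ (n ∸ j))

  through-right : ∀ {j} → j ℕ.≤ n → Through n j
  through-right {j} j≤n = trans (cong X e) (X-right (ℕ.m≤m+n (n ℕ.+ n) j)) ,
                    trans (cong Y e) (trans (Y-right (ℕ.m≤m+n (n ℕ.+ n) j)) (ℕ.m+n∸m≡n (n ℕ.+ n) j))
    where
    e : param n j ≡ n ℕ.+ n ℕ.+ j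
    e = cong₂ ℕ._+_ (cong (n ℕ.+ n ∸_) (ℕ.m≤n⇒m∸n≡0 j≤n)) (cong (j ∸_) (ℕ.n∸n≡0 n))

  through-base : ∀ {i} → i ℕ.≤ n → Through i 0
  through-base {i} i≤n = trans (cong X e) (trans (cong (_⊓ n) (ℕ.m+n∸m≡n n i)) (ℕ.m≤n⇒m⊓n≡m i≤n)) ,
                   trans (cong Y e) (Y-base (ℕ.m≤m+n n i) (ℕ.+-monoʳ-≤ n i≤n))
    where
    e : param i 0 ≡ n ℕ.+ i
    e = trans (cong₂ ℕ._+_ (cong (n ℕ.+ i ∸_) (ℕ.0∸n≡0 i)) (ℕ.0∸n≡0 (n ∸ i))) (ℕ.+-identityʳ (n ℕ.+ i))

  lower-fixed : ∀ {i j} → Through (toℕ i) (toℕ j) → lower (i , j) ≡ (i , j)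
  lower-fixed {i} {j} (p , q) =
    cong₂ _,_ (trans (cong clamp p) (clamp-toℕ i)) (trans (cong clamp q) (clamp-toℕ j))

  upper-fixed : ∀ {i j} → Through (toℕ i) (n ∸ toℕ j) → upper (i , j) ≡ (i , j)
  upper-fixed {i} {j} (p , q) = cong₂ _,_ (trans (cong clamp p) (clamp-toℕ i))
    (trans (cong clamp (trans (cong (n ∸_) q) (ℕ.m∸[m∸n]≡n (Fin.toℕ≤pred[n] j)))) (clamp-toℕ j))

  -- Both maps fix the left and right sides. On the bottom `lower` is the identity and the upper
  -- weight vanishes; on the top the roles are exchanged.
  endpoints : ∀ u → Boundary u →
              (lower u ≡ u ⊎ n ∸ toℕ (proj₂ u) ≡ 0) × (upper u ≡ u ⊎ toℕ (proj₂ u) ≡ 0)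
  endpoints (i , j) (inj₁ (inj₁ i≡0)) =
    inj₁ (lower-fixed (subst (λ k → Through k (toℕ j)) (sym i≡0) (through-left (Fin.toℕ≤pred[n] j)))) ,
    inj₁ (upper-fixed (subst (λ k → Through k (n ∸ toℕ j)) (sym i≡0) (through-left (ℕ.m∸n≤m n (toℕ j)))))
  endpoints (i , j) (inj₁ (inj₂ i≡n)) =
    inj₁ (lower-fixed (subst (λ k → Through k (toℕ j)) (sym (ℕ.suc-injective i≡n))
      (through-right (Fin.toℕ≤pred[n] j)))) ,
    inj₁ (upper-fixed (subst (λ k → Through k (n ∸ toℕ j)) (sym (ℕ.suc-injective i≡n))
      (through-right (ℕ.m∸n≤m n (toℕ j)))))
  endpoints (i , j) (inj₂ (inj₁ j≡0)) =
    inj₁ (lower-fixed (subst (Through (toℕ i)) (sym j≡0) (through-base (Fin.toℕ≤pred[n] i)))) ,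
    inj₂ j≡0
  endpoints (i , j) (inj₂ (inj₂ j≡n)) =
    inj₂ n∸j≡0 ,
    inj₁ (upper-fixed (subst (Through (toℕ i)) (sym n∸j≡0) (through-base (Fin.toℕ≤pred[n] i))))
    where
    n∸j≡0 : n ∸ toℕ j ≡ 0
    n∸j≡0 = trans (cong (n ∸_) (ℕ.suc-injective j≡n)) (ℕ.n∸n≡0 n)

  levels : ∀ {i j k l} → Adjacent (suc n) (i , j) (k , l) →
           toℕ j ≡ toℕ l ⊎ toℕ l ≡ suc (toℕ j) ⊎ toℕ j ≡ suc (toℕ l)
  levels                 (inj₁ (_ , j≡l)) = inj₁ (cong toℕ j≡l)
  levels {j = j} {l = l} (inj₂ (_ , ≡1))  = inj₂ (∣∣≡1⇒suc (toℕ j) (toℕ l) ≡1)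

  -- The value is 3 + 6: speed 3 of the two maps, and distance `6 * n` for the transferred mass 1/n.
  feasible-9 : .{{ℕ.NonZero n}} → FeasibleValue (fromℚ (ℕ→ℚ 9))
  feasible-9 = Interpolation.interpolation-feasible (grid (suc n)) (boundaryCycle (suc n)) n 3 6
    (λ u → toℕ (proj₂ u)) lower upper
    (λ u → Fin.toℕ≤pred[n] (proj₂ u))
    levels lower-boundary upper-boundary endpoints
    (λ u~v → proj₁ (close⇒d (lower-close u~v)))
    (λ u~v → proj₁ (close⇒d (upper-close u~v)))
    (λ u v → close⇒d (lower-upper-close u v))

-- A parity obstruction to labelling the grid by sides.

pattern bottom = 0F
pattern right  = 1F
pattern top    = 2F
pattern left   = 3F

Side : Set
Side = Fin 4

opposite : Side → Side → Bool
opposite bottom top    = true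
opposite top    bottom = true
opposite left   right  = true
opposite right  left   = true
opposite _      _      = false

crossing : Side → Side → Bool
crossing bottom right  = true
crossing right  bottom = true
crossing _      _      = false

someOpposite : (a b c d : Side) → Bool
someOpposite a b c d =
  opposite a b ∨ opposite a c ∨ opposite a d ∨ opposite b c ∨ opposite b d ∨ opposite c d

-- Without opposite labels at most two sides occur. If they are bottom and right, a closed tour
-- changes between them an even number of times; otherwise nothing crosses. The 256 cases are
-- decided by evaluation.
crossing-square : ∀ a b c d → someOpposite a b c d ≡ false →
  crossing a b xor crossing b c ≡ crossing a d xor crossing d c
crossing-square = from-yes (Fin.all? λ a → Fin.all? λ b → Fin.all? λ c → Fin.all? λ d →
  (someOpposite a b c d Bool.≟ false) →-dec (crossing a b xor crossing b c Bool.≟ crossing a d xor crossing d c))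

parity : (ℕ → Bool) → ℕ → Bool
parity g zero    = false
parity g (suc k) = parity g k xor g k

parity-false : ∀ g k → (∀ x → x ℕ.< k → g x ≡ false) → parity g k ≡ false
parity-false g zero    g≡f = refl
parity-false g (suc k) g≡f = cong₂ _xor_
  (parity-false g k λ x x<k → g≡f x (ℕ.m<n⇒m<1+n x<k)) (g≡f k ℕ.≤-refl)

parity-first : ∀ g k → g 0 ≡ true → (∀ x → suc x ℕ.≤ k → g (suc x) ≡ false) → parity g (suc k) ≡ true
parity-first g zero    g0 g≡f = g0
parity-first g (suc k) g0 g≡f = cong₂ _xor_
  (parity-first g k g0 λ x x<k → g≡f x (ℕ.m≤n⇒m≤1+n x<k)) (g≡f k ℕ.≤-refl)

-- Discrete Green theorem mod 2: h and v live on the horizontal and vertical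
-- edges, and their sum around every unit square vanishes.
module Green (h v : ℕ → ℕ → Bool)
  (square : ∀ x y → h x y xor v (suc x) y ≡ v x y xor h x (suc y)) where

  -- Adding the unit squares of one row from left to right, the interior vertical edges cancel.
  strip : ∀ k y → parity (λ x → h x y) k xor v k y ≡ v 0 y xor parity (λ x → h x (suc y)) k
  strip zero    y = sym (Bool.xor-identityʳ (v 0 y))
  strip (suc k) y = begin
    (P xor h k y) xor v (suc k) y    ≡⟨ Bool.xor-assoc P (h k y) (v (suc k) y) ⟩
    P xor (h k y xor v (suc k) y)    ≡⟨ cong (P xor_) (square k y) ⟩
    P xor (v k y xor h k (suc y))    ≡⟨ Bool.xor-assoc P (v k y) (h k (suc y)) ⟨
    (P xor v k y) xor h k (suc y)    ≡⟨ cong (_xor h k (suc y)) (strip k y) ⟩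
    (v 0 y xor Q) xor h k (suc y)    ≡⟨ Bool.xor-assoc (v 0 y) Q (h k (suc y)) ⟩
    v 0 y xor (Q xor h k (suc y))    ∎
    where
    open ≡-Reasoning
    P = parity (λ x → h x y) k
    Q = parity (λ x → h x (suc y)) k

  -- Stacking the strips cancels the interior horizontal edges.
  rectangle : ∀ n k → parity (λ x → h x 0) n xor parity (v n) k ≡
                              parity (v 0) k xor parity (λ x → h x k) n
  rectangle n zero    = Bool.xor-identityʳ _
  rectangle n (suc k) = begin
    B xor (R xor v n k)                    ≡⟨ Bool.xor-assoc B R (v n k) ⟨
    (B xor R) xor v n k                    ≡⟨ cong (_xor v n k) (rectangle n k) ⟩
    (L xor T) xor v n k                    ≡⟨ Bool.xor-assoc L T (v n k) ⟩
    L xor (T xor v n k)                    ≡⟨ cong (L xor_) (strip n k) ⟩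
    L xor (v 0 k xor parity (λ x → h x (suc k)) n)  ≡⟨ Bool.xor-assoc L (v 0 k) _ ⟨
    (L xor v 0 k) xor parity (λ x → h x (suc k)) n  ∎
    where
    open ≡-Reasoning
    B = parity (λ x → h x 0) n
    R = parity (v n) k
    L = parity (v 0) k
    T = parity (λ x → h x k) n

not-right⇒no-crossing : ∀ {a b} → a ≢ right → b ≢ right → crossing a b ≡ false
not-right⇒no-crossing {bottom} {bottom} _ _ = refl
not-right⇒no-crossing {bottom} {right}  _ q = contradiction refl q
not-right⇒no-crossing {bottom} {top}    _ _ = refl
not-right⇒no-crossing {bottom} {left}   _ _ = refl
not-right⇒no-crossing {right}  p _ = contradiction refl p
not-right⇒no-crossing {top}    _ _ = refl
not-right⇒no-crossing {left}   _ _ = refl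

not-bottom⇒no-crossing : ∀ {a b} → a ≢ bottom → b ≢ bottom → crossing a b ≡ false
not-bottom⇒no-crossing {bottom} p _ = contradiction refl p
not-bottom⇒no-crossing {right}  {bottom} _ q = contradiction refl q
not-bottom⇒no-crossing {right}  {right}  _ _ = refl
not-bottom⇒no-crossing {right}  {top}    _ _ = refl
not-bottom⇒no-crossing {right}  {left}   _ _ = refl
not-bottom⇒no-crossing {top}    _ _ = refl
not-bottom⇒no-crossing {left}   _ _ = refl

-- The bottom row keeps the label `bottom` up to its right end, so the only boundary edge that
-- crosses is the lowest one of the right column. On the left column and the top row, excluding one
-- of the two labels already rules out crossings, whatever happens at the corners.
no-separated-labelling : ∀ n (c : ℕ → ℕ → Side) →
  (∀ x → x ℕ.≤ suc n → c x 0 ≡ bottom) →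
  (∀ y → suc y ℕ.≤ suc n → c (suc n) (suc y) ≡ right) →
  (∀ y → y ℕ.≤ suc n → c 0 y ≢ right) →
  (∀ x → x ℕ.≤ suc n → c x (suc n) ≢ bottom) →
  (∀ x y x′ y′ → ∣ x - x′ ∣ ℕ.≤ 1 → ∣ y - y′ ∣ ℕ.≤ 1 → opposite (c x y) (c x′ y′) ≡ false) →
  ⊥
no-separated-labelling n c bot rig lef up near = contradiction
  (begin
    true                                          ≡⟨ cong₂ _xor_ bottom-row right-column ⟨
    parity (λ x → h x 0) (suc n) xor parity (v (suc n)) (suc n)
                                                  ≡⟨ Green.rectangle h v square (suc n) (suc n) ⟩
    parity (v 0) (suc n) xor parity (λ x → h x (suc n)) (suc n)
                                                  ≡⟨ cong₂ _xor_ left-column top-row ⟩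
    false                                         ∎)
  λ ()
  where
  open ≡-Reasoning
  h v : ℕ → ℕ → Bool
  h x y = crossing (c x y) (c (suc x) y)
  v x y = crossing (c x y) (c x (suc y))

  square : ∀ x y → h x y xor v (suc x) y ≡ v x y xor h x (suc y)
  -- The corners are listed counterclockwise from (x , y); the six facts below follow the order of
  -- pairs in `someOpposite`.
  square x y = crossing-square (c x y) (c (suc x) y) (c (suc x) (suc y)) (c x (suc y))
    (cong₂ _∨_ (near _ _ _ _ (step x) (stay y))
    (cong₂ _∨_ (near _ _ _ _ (step x) (step y))
    (cong₂ _∨_ (near _ _ _ _ (stay x) (step y))
    (cong₂ _∨_ (near _ _ _ _ (stay (suc x)) (step y))
    (cong₂ _∨_ (near _ _ _ _ (back x) (step y))
               (near _ _ _ _ (back x) (stay (suc y))))))))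
    where
    stay : ∀ k → ∣ k - k ∣ ℕ.≤ 1
    stay k = ℕ.≤-trans (ℕ.≤-reflexive (ℕ.∣n-n∣≡0 k)) z≤n
    step : ∀ k → ∣ k - suc k ∣ ℕ.≤ 1
    step k = ℕ.≤-reflexive (∣∣-suc k)
    back : ∀ k → ∣ suc k - k ∣ ℕ.≤ 1
    back k = ℕ.≤-trans (ℕ.≤-reflexive (ℕ.∣-∣-comm (suc k) k)) (step k)

  bottom-row : parity (λ x → h x 0) (suc n) ≡ false
  bottom-row = parity-false _ (suc n) λ x x< → cong₂ crossing (bot x (ℕ.<⇒≤ x<)) (bot (suc x) x<)

  right-column : parity (v (suc n)) (suc n) ≡ true
  right-column = parity-first _ n (cong₂ crossing (bot (suc n) ℕ.≤-refl) (rig 0 (s≤s z≤n)))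
    λ y y< → cong₂ crossing (rig y (ℕ.m≤n⇒m≤1+n y<)) (rig (suc y) (s≤s y<))

  left-column : parity (v 0) (suc n) ≡ false
  left-column = parity-false _ (suc n) λ y y< → not-right⇒no-crossing (lef y (ℕ.<⇒≤ y<)) (lef (suc y) y<)

  top-row : parity (λ x → h x (suc n)) (suc n) ≡ false
  top-row = parity-false _ (suc n) λ x x< → not-bottom⇒no-crossing (up x (ℕ.<⇒≤ x<)) (up (suc x) x<)

-- From the stretch of a retraction to a labelling by sides.

length-cartesianProduct-≥ : ∀ {A B : Set} (x : A) xs (ys : List B) →
                            length ys ℕ.≤ length (cartesianProduct (x ∷ xs) ys)
length-cartesianProduct-≥ x xs ys = begin
  length ys                                   ≡⟨ List.length-map (x ,_) ys ⟨
  length (map (x ,_) ys)                      ≤⟨ ℕ.m≤m+n _ _ ⟩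
  length (map (x ,_) ys) ℕ.+ length (cartesianProduct xs ys)
                                              ≡⟨ List.length-++ (map (x ,_) ys) ⟨
  length (cartesianProduct (x ∷ xs) ys)       ∎
  where open ℕ.≤-Reasoning

module Stretch (G : Graph) (H : Subgraph G) where
  open Graph G
  open Retraction G H

  d≤stretch : ∀ f {u v} → u ~ v → d (f u) (f v) ℕ.≤ stretch f
  d≤stretch f {u} {v} u~v = All.lookup (xs≤max 0 (map _ edges))
    (∈-map⁺ (λ (u , v) → d (f u) (f v))
      (∈-filter⁺ (λ (u , v) → u ~? v) (∈-cartesianProduct⁺ (complete u) (complete v)) u~v))

module GridStretch (n : ℕ) where
  open Grid n
  open Retraction (grid (suc n)) (boundaryCycle (suc n))

  -- Displacement in the sup norm of the grid. The lower bound uses `d` only through its domination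
  -- of this distance.
  Within : ℕ → Cell (suc n) → Cell (suc n) → Set
  Within k (i , j) (i′ , j′) = ∣ toℕ i - toℕ i′ ∣ ℕ.≤ k × ∣ toℕ j - toℕ j′ ∣ ℕ.≤ k

  within-refl : ∀ {k} u → Within k u u
  within-refl (i , j) = subst (ℕ._≤ _) (sym (ℕ.∣n-n∣≡0 (toℕ i))) z≤n ,
                        subst (ℕ._≤ _) (sym (ℕ.∣n-n∣≡0 (toℕ j))) z≤n

  within-trans : ∀ {k l} u v w → Within k u v → Within l v w → Within (k ℕ.+ l) u w
  within-trans (i , j) (i′ , j′) (i″ , j″) (p , q) (p′ , q′) =
    ℕ.≤-trans (ℕ.∣-∣-triangle (toℕ i) (toℕ i′) (toℕ i″)) (ℕ.+-mono-≤ p p′) ,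
    ℕ.≤-trans (ℕ.∣-∣-triangle (toℕ j) (toℕ j′) (toℕ j″)) (ℕ.+-mono-≤ q q′)

  adjacent⇒within : ∀ {u v} → Adjacent (suc n) u v → Within 1 u v
  adjacent⇒within {i , j} (inj₁ (p , refl)) = ℕ.≤-reflexive p , proj₂ (within-refl (i , j))
  adjacent⇒within {i , j} (inj₂ (refl , q)) = proj₁ (within-refl (i , j)) , ℕ.≤-reflexive q

  walk⇒within : ∀ k {u v} → Walk k u v → Within k u v
  walk⇒within zero    {u} refl = within-refl u
  walk⇒within (suc k) {u} {v} (w , (_ , _ , u~w) , p) =
    within-trans u w v (adjacent⇒within u~w) (walk⇒within k p)

  -- Fixing the first coordinate already leaves `suc n` cells.
  n<∣vertices∣ : n ℕ.< length (cartesianProduct (allFin (suc n)) (allFin (suc n)))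
  n<∣vertices∣ = subst (ℕ._≤ length (cartesianProduct (allFin (suc n)) (allFin (suc n))))
    (List.length-tabulate {n = suc n} (λ i → i))
    (length-cartesianProduct-≥ Fin.zero (tabulate {n = n} Fin.suc) (allFin (suc n)))

  within-n : ∀ u v → Within n u v
  within-n (i , j) (k , l) = bound i k , bound j l
    where
    bound : (i k : Fin (suc n)) → ∣ toℕ i - toℕ k ∣ ℕ.≤ n
    bound i k = ℕ.≤-trans (ℕ.∣m-n∣≤m⊔n (toℕ i) (toℕ k)) (ℕ.⊔-lub (Fin.toℕ≤pred[n] i) (Fin.toℕ≤pred[n] k))

  within-mono : ∀ {k l} u v → k ℕ.≤ l → Within k u v → Within l u v
  within-mono _ _ k≤l (p , q) = ℕ.≤-trans p k≤l , ℕ.≤-trans q k≤l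

  -- Beyond the search bound of d the estimate is trivial, so no
  -- connectivity of the boundary cycle is needed.
  within-search : ∀ u v k → (k ℕ.< length (cartesianProduct (allFin (suc n)) (allFin (suc n))) → Walk k u v) →
                  Within k u v
  within-search u v k walk = [ (λ k<N → walk⇒within k (walk k<N))
                             , (λ N≤k → within-mono u v (ℕ.≤-trans (ℕ.<⇒≤ n<∣vertices∣) N≤k) (within-n u v))
                             ]′ (ℕ.<-≤-connex k _)

  within-d : ∀ u v → Within (d u v) u v
  within-d u v = within-search u v (d u v) d-walk

  OnSide : Side → Cell (suc n) → Set
  OnSide bottom (i , j) = toℕ j ≡ 0
  OnSide right  (i , j) = toℕ i ≡ n
  OnSide top    (i , j) = toℕ j ≡ n
  OnSide left   (i , j) = toℕ i ≡ 0

  -- The order of the tests settles the corners: both lower ones are `bottom`, the upper right one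
  -- is `right`, the upper left one is `top`. The default `left` is meaningful only on the boundary.
  side : Cell (suc n) → Side
  side (i , j) with toℕ j ℕ.≟ 0 | toℕ i ℕ.≟ n | toℕ j ℕ.≟ n
  ... | yes _ | _     | _     = bottom
  ... | no  _ | yes _ | _     = right
  ... | no  _ | no  _ | yes _ = top
  ... | no  _ | no  _ | no  _ = left

  onSide-side : ∀ u → Boundary u → OnSide (side u) u
  onSide-side (i , j) b with toℕ j ℕ.≟ 0 | toℕ i ℕ.≟ n | toℕ j ℕ.≟ n
  ... | yes j≡0 | _       | _       = j≡0
  ... | no  _   | yes i≡n | _       = i≡n
  ... | no  _   | no  _   | yes j≡n = j≡n
  onSide-side (i , j) (inj₁ (inj₁ i≡0)) | no _   | no _   | no _   = i≡0
  onSide-side (i , j) (inj₁ (inj₂ i≡n)) | no _   | no i≢n | no _   = contradiction (ℕ.suc-injective i≡n) i≢n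
  onSide-side (i , j) (inj₂ (inj₁ j≡0)) | no j≢0 | no _   | no _   = contradiction j≡0 j≢0
  onSide-side (i , j) (inj₂ (inj₂ j≡n)) | no _   | no _   | no j≢n = contradiction (ℕ.suc-injective j≡n) j≢n

  side-bottom : ∀ u → toℕ (proj₂ u) ≡ 0 → side u ≡ bottom
  side-bottom (i , j) j≡0 with toℕ j ℕ.≟ 0
  ... | yes _  = refl
  ... | no j≢0 = contradiction j≡0 j≢0

  side-right : ∀ u → toℕ (proj₂ u) ≢ 0 → toℕ (proj₁ u) ≡ n → side u ≡ right
  side-right (i , j) j≢0 i≡n with toℕ j ℕ.≟ 0 | toℕ i ℕ.≟ n
  ... | yes j≡0 | _      = contradiction j≡0 j≢0
  ... | no _    | yes _  = refl
  ... | no _    | no i≢n = contradiction i≡n i≢n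

  -- Opposite sides differ by exactly `n` in one coordinate.
  opposite⇒far : ∀ s t {u v k} → opposite s t ≡ true → OnSide s u → OnSide t v → Within k u v → n ℕ.≤ k
  opposite⇒far bottom top    _ p q (_ , w) rewrite p | q = w
  opposite⇒far top    bottom _ p q (_ , w) rewrite p | q | ℕ.∣-∣-identityʳ n = w
  opposite⇒far left   right  _ p q (w , _) rewrite p | q = w
  opposite⇒far right  left   _ p q (w , _) rewrite p | q | ℕ.∣-∣-identityʳ n = w
  opposite⇒far bottom bottom ()
  opposite⇒far bottom right  ()
  opposite⇒far bottom left   ()
  opposite⇒far right  bottom ()
  opposite⇒far right  right  ()
  opposite⇒far right  top    ()
  opposite⇒far top    right  ()
  opposite⇒far top    top    ()
  opposite⇒far top    left   ()
  opposite⇒far left   bottom ()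
  opposite⇒far left   top    ()
  opposite⇒far left   left   ()

  module _ (f : Cell (suc n) → Cell (suc n)) (ret : IsRetraction f)
           (s : ℕ) (image : ∀ {u v} → Adjacent (suc n) u v → Within s (f u) (f v)) where
    open IsRetraction ret

    column-image : ∀ x y y′ → ∣ y - y′ ∣ ℕ.≤ 1 → Within s (f (cell x y)) (f (cell x y′))
    column-image x y y′ ≤1 with clamp-≤1 {y} {y′} ≤1
    ... | inj₁ e  = subst (λ z → Within s (f (cell x y)) (f (clamp x , z))) e (within-refl (f (cell x y)))
    ... | inj₂ ≡1 = image (inj₂ (refl , ≡1))

    row-image : ∀ x x′ y → ∣ x - x′ ∣ ℕ.≤ 1 → Within s (f (cell x y)) (f (cell x′ y))
    row-image x x′ y ≤1 with clamp-≤1 {x} {x′} ≤1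
    ... | inj₁ e  = subst (λ z → Within s (f (cell x y)) (f (z , clamp y))) e (within-refl (f (cell x y)))
    ... | inj₂ ≡1 = image (inj₁ (≡1 , refl))

    label : ℕ → ℕ → Side
    label x y = side (f (cell x y))

    -- A boundary cell lies on the side that labels it, so a side not containing the cell is
    -- excluded without deciding how corners are labelled.
    onLabel : ∀ x y → Boundary (cell x y) → OnSide (label x y) (cell x y)
    onLabel x y b = subst (OnSide (label x y)) (fixes (cell x y) b) (onSide-side (f (cell x y)) (into (cell x y)))

    label-fixed : ∀ x y → Boundary (cell x y) → label x y ≡ side (cell x y)
    label-fixed x y b = cong side (fixes (cell x y) b)

    -- Diagonal neighbours are joined through (x′ , y); each of the two steps moves the image by at
    -- most `s`.
    no-opposite : s ℕ.+ s ℕ.< n → ∀ x y x′ y′ → ∣ x - x′ ∣ ℕ.≤ 1 → ∣ y - y′ ∣ ℕ.≤ 1 →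
                  opposite (label x y) (label x′ y′) ≡ false
    no-opposite 2s<n x y x′ y′ x≤1 y≤1 = Bool.¬-not λ eq → ℕ.<⇒≱ 2s<n
      (opposite⇒far (label x y) (label x′ y′) eq
        (onSide-side (f (cell x y)) (into (cell x y))) (onSide-side (f (cell x′ y′)) (into (cell x′ y′)))
        (within-trans (f (cell x y)) (f (cell x′ y)) (f (cell x′ y′))
          (row-image x x′ y x≤1) (column-image x′ y y′ y≤1)))

diameter≤ : ∀ n → let open Retraction (grid (suc n)) (boundaryCycle (suc n)) in
            ∀ f → IsRetraction f → ∀ s →
            (∀ {u v} → Adjacent (suc n) u v → GridStretch.Within n s (f u) (f v)) → n ℕ.≤ s ℕ.+ s
diameter≤ zero      f ret s image = z≤n
diameter≤ n@(suc k) f ret s image = ℕ.≮⇒≥ λ 2s<n → no-separated-labelling k (label f ret s image)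
  (λ x _ → trans (label-fixed f ret s image x 0 (inj₂ extreme-0)) (side-bottom (cell x 0) (toℕ-clamp 0)))
  (λ y y<n → trans (label-fixed f ret s image n (suc y) (inj₁ extreme-n))
    (side-right (cell n (suc y))
      -- The row is nonzero, so the lower right corner, labelled `bottom`, is avoided.
      (λ e → ℕ.1+n≢0 (trans (sym (toℕ-clamp-≤ y<n)) e))
      (toℕ-clamp-≤ ℕ.≤-refl)))
  -- A label `right` in the left column would force 0 to equal `n`, which is a successor here; the
  -- next argument treats `bottom` in the top row likewise.
  (λ y _ e → ℕ.0≢1+n (trans (sym (toℕ-clamp 0))
    (subst (λ t → OnSide t (cell 0 y)) e (onLabel f ret s image 0 y (inj₁ extreme-0)))))
  (λ x _ e → ℕ.1+n≢0 (trans (sym (toℕ-clamp-≤ ℕ.≤-refl))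
    (subst (λ t → OnSide t (cell x n)) e (onLabel f ret s image x n (inj₂ extreme-n)))))
  (no-opposite f ret s image 2s<n)
  where
  open Grid n
  open GridStretch n

module _ (n : ℕ) where
  open Retraction (grid (suc n)) (boundaryCycle (suc n))
  open GridStretch n

  n≤2*stretch : ∀ f → IsRetraction f → n ℕ.≤ stretch f ℕ.+ stretch f
  n≤2*stretch f ret = diameter≤ n f ret (stretch f) λ {u} {v} u~v →
    within-mono (f u) (f v) (Stretch.d≤stretch (grid (suc n)) (boundaryCycle (suc n)) f u~v) (within-d (f u) (f v))

-- The absolute constants.

⅓ ¹/₂₇ : ℚ
⅓    = + 1 ℚ./ 3
¹/₂₇ = + 1 ℚ./ 27

third : ∀ m s → m ℕ.≤ 3 ℕ.* s → ⅓ ℚ.* ℕ→ℚ m ℚ.≤ ℕ→ℚ s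
third m s m≤3s = begin
  ⅓ ℚ.* ℕ→ℚ m                ≤⟨ ℚ.*-monoˡ-≤-nonNeg ⅓ (ℕ→ℚ-mono-≤ m≤3s) ⟩
  ⅓ ℚ.* ℕ→ℚ (3 ℕ.* s)        ≡⟨ cong (⅓ ℚ.*_) (ℕ→ℚ-* 3 s) ⟩
  ⅓ ℚ.* (ℕ→ℚ 3 ℚ.* ℕ→ℚ s)   ≡⟨ ℚ.*-assoc ⅓ (ℕ→ℚ 3) (ℕ→ℚ s) ⟨
  1ℚ ℚ.* ℕ→ℚ s               ≡⟨ ℚ.*-identityˡ (ℕ→ℚ s) ⟩
  ℕ→ℚ s                      ∎
  where open ℚ.≤-Reasoning

-- With optimum at most 9 and stretch at least m/3, the ratio is at least m/27.
gap : ∀ m s v .{{_ : ℕ.NonZero m}} → m ℕ.≤ 3 ℕ.* s → v ≤ᵣ fromℚ (ℕ→ℚ 9) →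
      (¹/₂₇ ℚ.* ℕ→ℚ m) · v ≤ᵣ fromℚ (ℕ→ℚ s)
gap m s v m≤3s v≤9 = ·-bound (¹/₂₇ ℚ.* ℕ→ℚ m) v (ℕ→ℚ 9) (ℕ→ℚ s)
  (ℚ.pos*pos⇒pos ¹/₂₇ (ℕ→ℚ m) {{ℚ.normalize-pos m 1}}) v≤9
  (begin
    ¹/₂₇ ℚ.* ℕ→ℚ m ℚ.* ℕ→ℚ 9      ≡⟨ ℚ.*-assoc ¹/₂₇ (ℕ→ℚ m) (ℕ→ℚ 9) ⟩
    ¹/₂₇ ℚ.* (ℕ→ℚ m ℚ.* ℕ→ℚ 9)    ≡⟨ cong (¹/₂₇ ℚ.*_) (ℚ.*-comm (ℕ→ℚ m) (ℕ→ℚ 9)) ⟩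
    ¹/₂₇ ℚ.* (ℕ→ℚ 9 ℚ.* ℕ→ℚ m)    ≡⟨ ℚ.*-assoc ¹/₂₇ (ℕ→ℚ 9) (ℕ→ℚ m) ⟨
    -- The closed product of 1/27 and 9 evaluates to 1/3.
    ⅓ ℚ.* ℕ→ℚ m                    ≤⟨ third m s m≤3s ⟩
    ℕ→ℚ s                          ∎)
  where open ℚ.≤-Reasoning

-- Passes from `n` to the side length `suc n`: as `n` is positive so is `s`, and a further `s`
-- absorbs the extra 1.
1+n≤3*s : ∀ {n s} → 1 ℕ.≤ n → n ℕ.≤ s ℕ.+ s → suc n ℕ.≤ 3 ℕ.* s
1+n≤3*s {s = zero}  1≤n n≤0  = contradiction (ℕ.≤-trans 1≤n n≤0) λ ()
1+n≤3*s {s = suc s} _   n≤2s = ℕ.+-mono-≤ (s≤s (z≤n {s}))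
  (ℕ.≤-trans n≤2s (ℕ.≤-reflexive (cong (suc s ℕ.+_) (sym (ℕ.+-identityʳ (suc s))))))

module _ (n : ℕ) .{{_ : ℕ.NonZero n}} where
  open Retraction (grid (suc n)) (boundaryCycle (suc n))

  1+n≤3*stretch : ∀ f → IsRetraction f → suc n ℕ.≤ 3 ℕ.* stretch f
  1+n≤3*stretch f ret = 1+n≤3*s {s = stretch f} (ℕ.>-nonZero⁻¹ n) (n≤2*stretch n f ret)

  optimum-≤9 : ∀ v → IsLPOptimum v → v ≤ᵣ fromℚ (ℕ→ℚ 9)
  optimum-≤9 v (lowerBound , _) = lowerBound (fromℚ (ℕ→ℚ 9)) (Grid.feasible-9 n)

  gridBounds : (∃ λ s → FeasibleValue s × s ≤ᵣ fromℚ (ℕ→ℚ 9))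
             × (∀ v → IsLPOptimum v → v ≤ᵣ fromℚ (ℕ→ℚ 9))
             × (∀ f → IsRetraction f → ⅓ ℚ.* ℕ→ℚ (suc n) ℚ.≤ ℕ→ℚ (stretch f))
             × IntegralityGap≥ (¹/₂₇ ℚ.* ℕ→ℚ (suc n))
  gridBounds =
      (fromℚ (ℕ→ℚ 9) , Grid.feasible-9 n , pointwise⇒≤ₛ (λ _ → ℚ.≤-refl))
    , optimum-≤9
    , (λ f ret → third (suc n) (stretch f) (1+n≤3*stretch f ret))
    , (λ v opt f ret → gap (suc n) (stretch f) v (1+n≤3*stretch f ret) (optimum-≤9 v opt))

mainTheorem4 : ∃ λ (C : ℚ) → ∃ λ (c : ℚ) → ∃ λ (g : ℚ) →
    0ℚ ℚ.< C × 0ℚ ℚ.< c × 0ℚ ℚ.< g ×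
    (∀ (n √n : ℕ) → n ≡ √n ℕ.* √n → 3 ℕ.≤ √n →
    let open Retraction (grid √n) (boundaryCycle √n) in
    (∃ λ s → FeasibleValue s × s ≤ᵣ fromℚ C)
    × (∀ v → IsLPOptimum v → v ≤ᵣ fromℚ C)
    × (∀ f → IsRetraction f → c ℚ.* ℕ→ℚ √n ℚ.≤ ℕ→ℚ (stretch f))
    × IntegralityGap≥ (g ℚ.* ℕ→ℚ √n))
mainTheorem4 = ℕ→ℚ 9 , ⅓ , ¹/₂₇ , ℚ.positive⁻¹ (ℕ→ℚ 9) , ℚ.positive⁻¹ ⅓ , ℚ.positive⁻¹ ¹/₂₇ ,
  -- The side length is `suc n`; from `2 ≤ n` comes the nonzero `n` by which the weights are
  -- divided.
  λ { _ (suc n) _ (s≤s 2≤n) → gridBounds n {{ℕ.>-nonZero (ℕ.≤-trans (ℕ.n≤1+n 1) 2≤n)}} }
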